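{- Let $G=(V,E)$ be a finite undirected graph (loops and multiple edges allowed), let $S:=\{(v,i)\in V\times\mathbb{N} \mid 1\leq i\leq \deg_G(v)\}$, and let $r:2^S\to\mathbb{Z}$ be the function defined by $$r(X):=\max\{\mathrm{Hei}(\varphi)\mid \varphi \text{ is a labeling of } G \text{ with respect to } \alpha(X)\}.$$ Then: (a) $r$ is the rank function of a matroid $M=(S,r)$ on the ground set $S$, and $M$ is an identically self-dual (i.e. $M^\ast=M$) transversal matroid of rank $|E|$. (b) For every perfect subset $X$ of $S$, the deletion $M\backslash X$ is a bi-transversal matroid.
   Context: Degree: $\deg_G(v)$ is the number of edges incident to $v$, where a loop at $v$ contributes $2$. Labelings: let $\infty$ be a symbol with $\infty\notin V$, and let $\alpha=(m(v),\,v\in V)$ be a vector of non-negative integers. A labeling of $G$ with respect to $\alpha$ is a map $\varphi:E\to V\cup\{\infty\}$ such that (i) for every $e\in E$ with ends $v$ and $w$, $\varphi(e)\in\{v,w,\infty\}$; and (ii) $|\varphi^{ -1}(v)|\leq m(v)$ for each $v\in V$. Its height is $\mathrm{Hei}(\varphi):=|\{e\in E\mid \varphi(e)\neq\infty\}|$. $\alpha$-vector: for $X\subseteq S$, $\alpha(X):=(m_X(v),\,v\in V)$, where $m_X(v):=|\{i\mid (v,i)\in X\}|$. Perfect subsets: $X\subseteq S$ is perfect if there is $W\subseteq V$ with $X=\{(v,i)\in W\times\mathbb{N}\mid 1\leq i\leq\deg_G(v)\}$. Matroids: $M^\ast$ denotes the dual and $M\backslash X$ the deletion of $X$. A matroid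 on a finite set $S$ is transversal if there is a finite family $(A_1,\dots,A_n)$ of subsets of $S$ (repetitions allowed) such that its independent sets are exactly the partial transversals, i.e. the sets $I\subseteq S$ admitting an injection $f:I\to\{1,\dots,n\}$ with $x\in A_{f(x)}$ for all $x\in I$. A matroid is bi-transversal if both it and its dual are transversal. -}

module Defs where

open import Data.Bool.Base using (true; false)
open import Data.Bool.Properties using (∨-identityʳ)
open import Data.Fin.Base using (Fin; zero; suc; _↑ˡ_; _↑ʳ_; splitAt; join)
open import Data.Fin.Properties as Fin using (all?; splitAt-↑ˡ; splitAt-↑ʳ; join-splitAt)
open import Data.Fin.Subset
open import Data.Fin.Subset.Properties
open import Data.Integer.Base as ℤ using (ℤ; +_; 0ℤ)
import Data.Integer.Properties as ℤ
open import Data.Integer.Tactic.RingSolver using (solve-∀)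
open import Data.List.Base as List using (List; []; _∷_; cartesianProductWith; filter; allFin)
open import Data.List.Extrema.Nat using (max)
open import Data.Maybe.Base using (Maybe; just; nothing)
open import Data.Maybe.Properties using (≡-dec)
open import Data.Nat.Base as ℕ using (ℕ; zero; suc)
import Data.Nat.Properties as ℕ
open import Data.Product.Base using (Σ; Σ-syntax; ∃; ∃-syntax; _×_; _,_; proj₁; proj₂)
open import Data.Sum.Base using (_⊎_; inj₁; inj₂; [_,_]′)
open import Data.Vec.Base as Vec using (Vec; []; _∷_; lookup; tabulate; count)
open import Data.Vec.Functional using (foldr)
open import Function.Base using (_∘_)
open import Function.Bundles using (_↔_; _⇔_; mk↔ₛ′)
open import Function.Definitions using (Injective)
open import Relation.Binary.PropositionalEquality
open import Relation.Nullary.Decidable using (Dec; ¬?; _×-dec_; _⊎-dec_; yes; no)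

private variable
  n : ℕ

------------------------------------------------------------------------
-- Facts about finite subsets

∣p∪q∣+∣p∩q∣ : (p q : Subset n) → ∣ p ∪ q ∣ ℕ.+ ∣ p ∩ q ∣ ≡ ∣ p ∣ ℕ.+ ∣ q ∣
∣p∪q∣+∣p∩q∣ []          []          = refl
∣p∪q∣+∣p∩q∣ (false ∷ p) (false ∷ q) = ∣p∪q∣+∣p∩q∣ p q
∣p∪q∣+∣p∩q∣ (false ∷ p) (true  ∷ q) =
  trans (cong suc (∣p∪q∣+∣p∩q∣ p q)) (sym (ℕ.+-suc ∣ p ∣ ∣ q ∣))
∣p∪q∣+∣p∩q∣ (true  ∷ p) (false ∷ q) = cong suc (∣p∪q∣+∣p∩q∣ p q)
∣p∪q∣+∣p∩q∣ (true  ∷ p) (true  ∷ q) = cong suc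
  (trans (ℕ.+-suc ∣ p ∪ q ∣ ∣ p ∩ q ∣)
  (trans (cong suc (∣p∪q∣+∣p∩q∣ p q)) (sym (ℕ.+-suc ∣ p ∣ ∣ q ∣))))

p─q∪q≡p : (p q : Subset n) → q ⊆ p → (p ─ q) ∪ q ≡ p
p─q∪q≡p []          []          q⊆p = refl
p─q∪q≡p (x     ∷ p) (false ∷ q) q⊆p = cong₂ _∷_ (∨-identityʳ x) (p─q∪q≡p p q (drop-∷-⊆ q⊆p))
p─q∪q≡p (true  ∷ p) (true  ∷ q) q⊆p = cong (true ∷_) (p─q∪q≡p p q (drop-∷-⊆ q⊆p))
p─q∪q≡p (false ∷ p) (true  ∷ q) q⊆p with () ← q⊆p Vec.here

p─q∩q≡⊥ : (p q : Subset n) → (p ─ q) ∩ q ≡ ⊥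
p─q∩q≡⊥ []          []          = refl
p─q∩q≡⊥ (true  ∷ p) (true  ∷ q) = cong (false ∷_) (p─q∩q≡⊥ p q)
p─q∩q≡⊥ (true  ∷ p) (false ∷ q) = cong (false ∷_) (p─q∩q≡⊥ p q)
p─q∩q≡⊥ (false ∷ p) (true  ∷ q) = cong (false ∷_) (p─q∩q≡⊥ p q)
p─q∩q≡⊥ (false ∷ p) (false ∷ q) = cong (false ∷_) (p─q∩q≡⊥ p q)

∣p─q∣+∣q∣≡∣p∣ : (p q : Subset n) → q ⊆ p → ∣ p ─ q ∣ ℕ.+ ∣ q ∣ ≡ ∣ p ∣
∣p─q∣+∣q∣≡∣p∣ {n} p q q⊆p = begin
  ∣ p ─ q ∣ ℕ.+ ∣ q ∣                       ≡⟨ ∣p∪q∣+∣p∩q∣ (p ─ q) q ⟨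
  ∣ (p ─ q) ∪ q ∣ ℕ.+ ∣ (p ─ q) ∩ q ∣       ≡⟨ cong₂ (λ a b → ∣ a ∣ ℕ.+ ∣ b ∣) (p─q∪q≡p p q q⊆p) (p─q∩q≡⊥ p q) ⟩
  ∣ p ∣ ℕ.+ ∣ ⊥ {n} ∣                       ≡⟨ cong (∣ p ∣ ℕ.+_) (∣⊥∣≡0 n) ⟩
  ∣ p ∣ ℕ.+ 0                               ≡⟨ ℕ.+-identityʳ ∣ p ∣ ⟩
  ∣ p ∣                                     ∎
  where open ≡-Reasoning

p─[q∪r] : (p q r : Subset n) → p ─ (q ∪ r) ≡ (p ─ q) ∩ (p ─ r)
p─[q∪r] []          []          []          = refl
p─[q∪r] (x     ∷ p) (true  ∷ q) (_     ∷ r) = cong (false ∷_) (p─[q∪r] p q r)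
p─[q∪r] (true  ∷ p) (false ∷ q) (true  ∷ r) = cong (false ∷_) (p─[q∪r] p q r)
p─[q∪r] (false ∷ p) (false ∷ q) (true  ∷ r) = cong (false ∷_) (p─[q∪r] p q r)
p─[q∪r] (true  ∷ p) (false ∷ q) (false ∷ r) = cong (true ∷_) (p─[q∪r] p q r)
p─[q∪r] (false ∷ p) (false ∷ q) (false ∷ r) = cong (false ∷_) (p─[q∪r] p q r)

p─[q∩r] : (p q r : Subset n) → p ─ (q ∩ r) ≡ (p ─ q) ∪ (p ─ r)
p─[q∩r] []          []          []          = refl
p─[q∩r] (x     ∷ p) (true  ∷ q) (true  ∷ r) = cong (false ∷_) (p─[q∩r] p q r)
p─[q∩r] (true  ∷ p) (true  ∷ q) (false ∷ r) = cong (true ∷_) (p─[q∩r] p q r)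
p─[q∩r] (false ∷ p) (true  ∷ q) (false ∷ r) = cong (false ∷_) (p─[q∩r] p q r)
p─[q∩r] (true  ∷ p) (false ∷ q) (true  ∷ r) = cong (true ∷_) (p─[q∩r] p q r)
p─[q∩r] (false ∷ p) (false ∷ q) (true  ∷ r) = cong (false ∷_) (p─[q∩r] p q r)
p─[q∩r] (true  ∷ p) (false ∷ q) (false ∷ r) = cong (true ∷_) (p─[q∩r] p q r)
p─[q∩r] (false ∷ p) (false ∷ q) (false ∷ r) = cong (false ∷_) (p─[q∩r] p q r)

p─r⊆[p─q]∪[q─r] : (p q r : Subset n) → p ─ r ⊆ (p ─ q) ∪ (q ─ r)
p─r⊆[p─q]∪[q─r] p q r {x} x∈p─r with x ∈? q
... | no  x∉q = x∈p∪q⁺ (inj₁ (x∈p∧x∉q⇒x∈p─q (p─q⊆p p r x∈p─r) x∉q))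
... | yes x∈q = x∈p∪q⁺ (inj₂ (x∈p∧x∉q⇒x∈p─q x∈q x∉r))
  where
  x∉r : x ∉ r
  x∉r x∈r = ∉⊥ (subst (x ∈_) (p─q∩q≡⊥ p r) (x∈p∩q⁺ (x∈p─r , x∈r)))

∪-least : {p q s : Subset n} → p ⊆ s → q ⊆ s → p ∪ q ⊆ s
∪-least {p = p} {q} p⊆s q⊆s x∈ = [ p⊆s , q⊆s ]′ (x∈p∪q⁻ p q x∈)

------------------------------------------------------------------------
-- Matroids

record IsRankFunction (S : Subset n) (r : Subset n → ℤ) : Set where
  field
    nonNegative : ∀ X → X ⊆ S → 0ℤ ℤ.≤ r X
    bounded     : ∀ X → X ⊆ S → r X ℤ.≤ + ∣ X ∣
    monotone    : ∀ X Y → X ⊆ Y → Y ⊆ S → r X ℤ.≤ r Y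
    submodular  : ∀ X Y → X ⊆ S → Y ⊆ S →
                  r (X ∪ Y) ℤ.+ r (X ∩ Y) ℤ.≤ r X ℤ.+ r Y

  subadditive : ∀ X Y → X ⊆ S → Y ⊆ S → r (X ∪ Y) ℤ.≤ r X ℤ.+ r Y
  subadditive X Y X⊆S Y⊆S = begin
    r (X ∪ Y)                ≡⟨ ℤ.+-identityʳ _ ⟨
    r (X ∪ Y) ℤ.+ 0ℤ         ≤⟨ ℤ.+-monoʳ-≤ (r (X ∪ Y)) (nonNegative (X ∩ Y) (X⊆S ∘ p∩q⊆p X Y)) ⟩
    r (X ∪ Y) ℤ.+ r (X ∩ Y)  ≤⟨ submodular X Y X⊆S Y⊆S ⟩
    r X ℤ.+ r Y              ∎
    where open ℤ.≤-Reasoning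

-- The ground set is a subset of Fin n, so that deletion stays inside the same
-- type.  The values of rank on sets not contained in ground carry no meaning.
record Matroid (n : ℕ) : Set where
  field
    ground         : Subset n
    rank           : Subset n → ℤ
    isRankFunction : IsRankFunction ground rank
  open IsRankFunction isRankFunction public

open Matroid using (ground; rank)

matroid : (S : Subset n) (r : Subset n → ℤ) → IsRankFunction S r → Matroid n
matroid S r isRank = record { ground = S ; rank = r ; isRankFunction = isRank }

infix 4 _≈ᴹ_
_≈ᴹ_ : Matroid n → Matroid n → Set
M ≈ᴹ N = ground M ≡ ground N × (∀ X → X ⊆ ground M → rank M X ≡ rank N X)

dual : Matroid n → Matroid n
dual {n} M = record
  { ground         = S
  ; rank           = r*
  ; isRankFunction = record
    { nonNegative = nonNegative*
    ; bounded     = bounded*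
    ; monotone    = monotone*
    ; submodular  = submodular*
    }
  }
  where
  open Matroid M renaming (ground to S; rank to r)
  open ℤ.≤-Reasoning

  r* : Subset n → ℤ
  r* X = + ∣ X ∣ ℤ.- r S ℤ.+ r (S ─ X)

  nonNegative* : ∀ X → X ⊆ S → 0ℤ ℤ.≤ r* X
  nonNegative* X X⊆S = begin
    0ℤ                             ≡⟨ ℤ.+-inverseʳ (r S) ⟨
    r S ℤ.- r S                    ≡⟨ cong (λ Y → r Y ℤ.- r S) (p─q∪q≡p S X X⊆S) ⟨
    r ((S ─ X) ∪ X) ℤ.- r S        ≤⟨ ℤ.+-monoˡ-≤ (ℤ.- r S) (subadditive (S ─ X) X (p─q⊆p S X) X⊆S) ⟩
    r (S ─ X) ℤ.+ r X ℤ.- r S      ≤⟨ ℤ.+-monoˡ-≤ (ℤ.- r S) (ℤ.+-monoʳ-≤ (r (S ─ X)) (bounded X X⊆S)) ⟩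
    r (S ─ X) ℤ.+ + ∣ X ∣ ℤ.- r S  ≡⟨ rearrange (r (S ─ X)) (+ ∣ X ∣) (r S) ⟩
    r* X                           ∎
    where
    rearrange : ∀ a b c → a ℤ.+ b ℤ.- c ≡ b ℤ.- c ℤ.+ a
    rearrange = solve-∀

  bounded* : ∀ X → X ⊆ S → r* X ℤ.≤ + ∣ X ∣
  bounded* X X⊆S = begin
    + ∣ X ∣ ℤ.- r S ℤ.+ r (S ─ X)  ≤⟨ ℤ.+-monoʳ-≤ (+ ∣ X ∣ ℤ.- r S) (monotone (S ─ X) S (p─q⊆p S X) ⊆-refl) ⟩
    + ∣ X ∣ ℤ.- r S ℤ.+ r S        ≡⟨ rearrange (+ ∣ X ∣) (r S) ⟩
    + ∣ X ∣                        ∎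
    where
    rearrange : ∀ a b → a ℤ.- b ℤ.+ b ≡ a
    rearrange = solve-∀

  monotone* : ∀ X Y → X ⊆ Y → Y ⊆ S → r* X ℤ.≤ r* Y
  monotone* X Y X⊆Y Y⊆S = begin
    + ∣ X ∣ ℤ.- r S ℤ.+ r (S ─ X)                        ≤⟨ ℤ.+-monoʳ-≤ (+ ∣ X ∣ ℤ.- r S) step ⟩
    + ∣ X ∣ ℤ.- r S ℤ.+ (r (S ─ Y) ℤ.+ + ∣ Y ─ X ∣)      ≡⟨ rearrange (+ ∣ X ∣) (r S) (r (S ─ Y)) (+ ∣ Y ─ X ∣) ⟩
    (+ ∣ Y ─ X ∣ ℤ.+ + ∣ X ∣) ℤ.- r S ℤ.+ r (S ─ Y)      ≡⟨ cong (λ k → + k ℤ.- r S ℤ.+ r (S ─ Y)) (∣p─q∣+∣q∣≡∣p∣ Y X X⊆Y) ⟩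
    + ∣ Y ∣ ℤ.- r S ℤ.+ r (S ─ Y)                        ∎
    where
    rearrange : ∀ a b c d → a ℤ.- b ℤ.+ (c ℤ.+ d) ≡ (d ℤ.+ a) ℤ.- b ℤ.+ c
    rearrange = solve-∀

    Y─X⊆S : Y ─ X ⊆ S
    Y─X⊆S = Y⊆S ∘ p─q⊆p Y X

    step : r (S ─ X) ℤ.≤ r (S ─ Y) ℤ.+ + ∣ Y ─ X ∣
    step = begin
      r (S ─ X)                    ≤⟨ monotone (S ─ X) ((S ─ Y) ∪ (Y ─ X)) (p─r⊆[p─q]∪[q─r] S Y X)
                                        (∪-least (p─q⊆p S Y) Y─X⊆S) ⟩
      r ((S ─ Y) ∪ (Y ─ X))        ≤⟨ subadditive (S ─ Y) (Y ─ X) (p─q⊆p S Y) Y─X⊆S ⟩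
      r (S ─ Y) ℤ.+ r (Y ─ X)      ≤⟨ ℤ.+-monoʳ-≤ (r (S ─ Y)) (bounded (Y ─ X) Y─X⊆S) ⟩
      r (S ─ Y) ℤ.+ + ∣ Y ─ X ∣    ∎

  submodular* : ∀ X Y → X ⊆ S → Y ⊆ S → r* (X ∪ Y) ℤ.+ r* (X ∩ Y) ℤ.≤ r* X ℤ.+ r* Y
  submodular* X Y X⊆S Y⊆S = begin
    r* (X ∪ Y) ℤ.+ r* (X ∩ Y)
      ≡⟨ rearrange₁ (+ ∣ X ∪ Y ∣) (+ ∣ X ∩ Y ∣) (r S) (r (S ─ (X ∪ Y))) (r (S ─ (X ∩ Y))) ⟩
    (+ ∣ X ∪ Y ∣ ℤ.+ + ∣ X ∩ Y ∣) ℤ.- (r S ℤ.+ r S) ℤ.+ (r (S ─ (X ∩ Y)) ℤ.+ r (S ─ (X ∪ Y)))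
      ≡⟨ cong (λ k → + k ℤ.- (r S ℤ.+ r S) ℤ.+ (r (S ─ (X ∩ Y)) ℤ.+ r (S ─ (X ∪ Y)))) (∣p∪q∣+∣p∩q∣ X Y) ⟩
    (+ ∣ X ∣ ℤ.+ + ∣ Y ∣) ℤ.- (r S ℤ.+ r S) ℤ.+ (r (S ─ (X ∩ Y)) ℤ.+ r (S ─ (X ∪ Y)))
      ≡⟨ cong₂ (λ U V → + ∣ X ∣ ℤ.+ + ∣ Y ∣ ℤ.- (r S ℤ.+ r S) ℤ.+ (r U ℤ.+ r V)) (p─[q∩r] S X Y) (p─[q∪r] S X Y) ⟩
    (+ ∣ X ∣ ℤ.+ + ∣ Y ∣) ℤ.- (r S ℤ.+ r S) ℤ.+ (r ((S ─ X) ∪ (S ─ Y)) ℤ.+ r ((S ─ X) ∩ (S ─ Y)))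
      ≤⟨ ℤ.+-monoʳ-≤ ((+ ∣ X ∣ ℤ.+ + ∣ Y ∣) ℤ.- (r S ℤ.+ r S))
           (submodular (S ─ X) (S ─ Y) (p─q⊆p S X) (p─q⊆p S Y)) ⟩
    (+ ∣ X ∣ ℤ.+ + ∣ Y ∣) ℤ.- (r S ℤ.+ r S) ℤ.+ (r (S ─ X) ℤ.+ r (S ─ Y))
      ≡⟨ rearrange₂ (+ ∣ X ∣) (+ ∣ Y ∣) (r S) (r (S ─ X)) (r (S ─ Y)) ⟩
    r* X ℤ.+ r* Y
      ∎
    where
    rearrange₁ : ∀ a b c d e → a ℤ.- c ℤ.+ d ℤ.+ (b ℤ.- c ℤ.+ e) ≡ (a ℤ.+ b) ℤ.- (c ℤ.+ c) ℤ.+ (e ℤ.+ d)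
    rearrange₁ = solve-∀

    rearrange₂ : ∀ a b c d e → (a ℤ.+ b) ℤ.- (c ℤ.+ c) ℤ.+ (d ℤ.+ e) ≡ a ℤ.- c ℤ.+ d ℤ.+ (b ℤ.- c ℤ.+ e)
    rearrange₂ = solve-∀

infixl 5 _∖_
_∖_ : Matroid n → Subset n → Matroid n
M ∖ X = record
  { ground         = S ─ X
  ; rank           = r
  ; isRankFunction = record
    { nonNegative = λ Y Y⊆ → nonNegative Y (S─X⊆S ∘ Y⊆)
    ; bounded     = λ Y Y⊆ → bounded Y (S─X⊆S ∘ Y⊆)
    ; monotone    = λ Y Z Y⊆Z Z⊆ → monotone Y Z Y⊆Z (S─X⊆S ∘ Z⊆)
    ; submodular  = λ Y Z Y⊆ Z⊆ → submodular Y Z (S─X⊆S ∘ Y⊆) (S─X⊆S ∘ Z⊆)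
    }
  }
  where
  open Matroid M renaming (ground to S; rank to r)

  S─X⊆S : S ─ X ⊆ S
  S─X⊆S = p─q⊆p S X

Independent : Matroid n → Subset n → Set
Independent M I = I ⊆ ground M × rank M I ≡ + ∣ I ∣

PartialTransversal : ∀ {k} → (Fin k → Subset n) → Subset n → Set
PartialTransversal {k = k} A I =
  Σ[ f ∈ (∃ (_∈ I) → Fin k) ] Injective _≡_ _≡_ f × (∀ x → proj₁ x ∈ A (f x))

Transversal : Matroid n → Set
Transversal {n} M =
  Σ[ k ∈ ℕ ] Σ[ A ∈ (Fin k → Subset n) ]
    (∀ j → A j ⊆ ground M) ×
    (∀ I → I ⊆ ground M → Independent M I ⇔ PartialTransversal A I)

BiTransversal : Matroid n → Set
BiTransversal M = Transversal M × Transversal (dual M)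

IdenticallySelfDual : Matroid n → Set
IdenticallySelfDual M = dual M ≈ᴹ M

------------------------------------------------------------------------
-- The disjoint union of Fin (d v), v : Fin n, as a single Fin

total : (Fin n → ℕ) → ℕ
total = foldr ℕ._+_ 0

pair : (d : Fin n → ℕ) (v : Fin n) → Fin (d v) → Fin (total d)
pair d zero    i = i ↑ˡ total (d ∘ suc)
pair d (suc v) i = d zero ↑ʳ pair (d ∘ suc) v i

unpair : (d : Fin n → ℕ) → Fin (total d) → Σ[ v ∈ Fin n ] Fin (d v)
unpair {suc n} d s = [ (zero ,_) , (λ t → let (v , i) = unpair (d ∘ suc) t in suc v , i) ]′ (splitAt (d zero) s)

pair-unpair : (d : Fin n → ℕ) (s : Fin (total d)) → let (v , i) = unpair d s in pair d v i ≡ s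
pair-unpair {suc n} d s with splitAt (d zero) s | join-splitAt (d zero) (total (d ∘ suc)) s
... | inj₁ i | eq = eq
... | inj₂ t | eq = trans (cong (d zero ↑ʳ_) (pair-unpair (d ∘ suc) t)) eq

unpair-pair : (d : Fin n → ℕ) (v : Fin n) (i : Fin (d v)) → unpair d (pair d v i) ≡ (v , i)
unpair-pair d zero    i rewrite splitAt-↑ˡ (d zero) i (total (d ∘ suc)) = refl
unpair-pair d (suc v) i
  rewrite splitAt-↑ʳ (d zero) (total (d ∘ suc)) (pair (d ∘ suc) v i)
        | unpair-pair (d ∘ suc) v i = refl

Σ↔total : (d : Fin n → ℕ) → (Σ[ v ∈ Fin n ] Fin (d v)) ↔ Fin (total d)
Σ↔total d = mk↔ₛ′ (λ (v , i) → pair d v i) (unpair d) (pair-unpair d) (λ (v , i) → unpair-pair d v i)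

------------------------------------------------------------------------
-- Graphs and labelings

-- The two ends of an edge are listed in an arbitrary order; a loop lists its
-- vertex twice.
record Graph : Set where
  field
    ∣V∣ ∣E∣ : ℕ
    ends    : Fin ∣E∣ → Fin ∣V∣ × Fin ∣V∣

  V E : Set
  V = Fin ∣V∣
  E = Fin ∣E∣

allVecs : {A : Set} → List A → (k : ℕ) → List (Vec A k)
allVecs xs zero    = [] ∷ []
allVecs xs (suc k) = cartesianProductWith _∷_ xs (allVecs xs k)

module _ (G : Graph) where
  open Graph G

  -- A loop at v is counted once in each summand.
  deg : V → ℕ
  deg v = count (v Fin.≟_) (tabulate (proj₁ ∘ ends)) ℕ.+ count (v Fin.≟_) (tabulate (proj₂ ∘ ends))

  -- Σ↔total deg identifies Fin ∣S∣ with { (v , i) | i < deg v }: the second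
  -- coordinate is counted from 0 instead of from 1.
  ∣S∣ : ℕ
  ∣S∣ = total deg

  -- `nothing` is the symbol ∞.  Vectors rather than functions are used so that
  -- the maps E → V ∪ {∞} form a list that is complete up to _≡_.
  EdgeMap : Set
  EdgeMap = Vec (Maybe V) ∣E∣

  fibreSize : EdgeMap → V → ℕ
  fibreSize φ v = count (≡-dec Fin._≟_ (just v)) φ

  IsLabeling : (V → ℕ) → EdgeMap → Set
  IsLabeling m φ =
    (∀ e → let (v , w) = ends e in
       lookup φ e ≡ just v ⊎ lookup φ e ≡ just w ⊎ lookup φ e ≡ nothing) ×
    (∀ v → fibreSize φ v ℕ.≤ m v)

  isLabeling? : ∀ m φ → Dec (IsLabeling m φ)
  isLabeling? m φ =
    all? (λ e → let (v , w) = ends e in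
      (lookup φ e ≟ just v) ⊎-dec (lookup φ e ≟ just w) ⊎-dec (lookup φ e ≟ nothing)) ×-dec
    all? (λ v → fibreSize φ v ℕ.≤? m v)
    where
    _≟_ = ≡-dec Fin._≟_

  Hei : EdgeMap → ℕ
  Hei φ = count (λ l → ¬? (≡-dec Fin._≟_ l nothing)) φ

  edgeMaps : List EdgeMap
  edgeMaps = allVecs (nothing ∷ List.map just (allFin ∣V∣)) ∣E∣

  α : Subset ∣S∣ → V → ℕ
  α X v = ∣ tabulate (λ i → lookup X (pair deg v i)) ∣

  -- The constant map ∞ is always a labeling, so the default value 0 of max is
  -- never a value other than the height of some labeling.
  r : Subset ∣S∣ → ℤ
  r X = + max 0 (List.map Hei (filter (isLabeling? (α X)) edgeMaps))

  Perfect : Subset ∣S∣ → Set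
  Perfect X = ∃[ W ] (∀ v i → pair deg v i ∈ X ⇔ v ∈ W)

{-# OPTIONS --safe #-}
-- A set W of vertices bounds the height of every labeling with capacities m by the capacity outside
-- W plus the number of edges that W touches.  By induction on the edges, the least such bound is
-- attained (König): if neither end of a new edge allows a longer labeling, then the optimal bounds
-- avoiding either end can be intersected.  This min-max formula makes r submodular, and replacing
-- W by its complement exchanges the bounds for X with those for S ∖ X, which gives self-duality.
-- The same formula is Hall's condition for the sets A_e of all (v , i) with v an end of e.  For the
-- dual of M ∖ X with X perfect, exchanging W with its complement shows that independence is Hall's
-- condition for those A_e whose edge e has no end among the vertices of X.
module Submission where

open import Defs
open import Data.Fin.Subset using (⊤)
open import Data.Integer.Base using (+_)
open import Data.Product.Base using (Σ-syntax; _×_)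
open import Relation.Binary.PropositionalEquality using (_≡_)

import Algebra.Properties.CommutativeMonoid.Sum as Sum
open import Data.Bool.Base using (Bool; true; false; not; _∧_; _∨_; if_then_else_)
open import Data.Bool.Properties using (∧-zeroʳ; ∧-identityʳ; ∨-zeroʳ; not-involutive)
open import Data.Fin.Base using (Fin; zero; suc; _↑ˡ_; _↑ʳ_; inject≤)
open import Data.Fin.Properties as Fin using (injective⇒≤; inject≤-injective)
open import Data.Fin.Subset using (Subset; inside; _∈_; _∉_; _⊆_; _∪_; _∩_; _─_; ∣_∣; ⊥)
open import Data.Fin.Subset.Properties
import Data.Integer.Base as ℤ
import Data.Integer.Properties as ℤ
open import Data.Integer.Tactic.RingSolver renaming (solve-∀ to ℤ-solve-∀)
open import Data.List.Base as List using (List)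
open import Data.List.Extrema.Nat using (max; max≤v⁺; v≤max⁺)
import Data.List.Membership.Propositional as List
import Data.List.Membership.Propositional.Properties as List
import Data.List.Relation.Unary.All as All
import Data.List.Relation.Unary.All.Properties as All
open import Data.List.Relation.Unary.Any as Any using (here; there)
open import Data.Maybe.Base using (just; nothing)
open import Data.Maybe.Properties using (just-injective; ≡-dec)
open import Data.Nat.Base using (ℕ; zero; suc; _+_; _∸_; _≤_; z≤n; s≤s)
import Data.Nat.Properties as ℕ
open import Data.Nat.Tactic.RingSolver using (solve-∀)
open import Data.Product.Base using (∃; ∃-syntax; _,_; proj₁; proj₂)
open import Data.Sum.Base using (_⊎_; inj₁; inj₂)
open import Data.Unit.Base using (tt)
open import Data.Vec.Base using (Vec; []; _∷_; lookup; tabulate; count)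
open import Data.Vec.Properties
  using (lookup∘tabulate; tabulate∘lookup; tabulate-cong; lookup-zipWith;
         lookup⇒[]=; []=⇒lookup)
open import Data.Vec.Properties.WithK using ([]=-irrelevant)
open import Function.Base using (_∘_; const; id)
open import Function.Bundles using (_⇔_; mk⇔; Equivalence)
open import Function.Definitions using (Injective)
open import Relation.Binary.PropositionalEquality using (refl; sym; trans; cong; cong₂; subst; module ≡-Reasoning)
import Level
open import Relation.Nullary.Decidable using (Dec; yes; no; does; map′; _×-dec_; toWitness; dec-true)
open import Relation.Nullary.Negation using (contradiction)
open import Relation.Unary using (Pred; Decidable)

open Sum ℕ.+-0-commutativeMonoid using (sum; sum-cong-≗; ∑-distrib-+; sum-replicate-zero)

private variable
  k n : ℕ

-- Sums and indicators

infix 7 _unless_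
_unless_ : ℕ → Bool → ℕ
x unless true  = 0
x unless false = x

⟦_⟧ : Bool → ℕ
⟦ b ⟧ = 1 unless not b

zero-unless : ∀ b → 0 unless b ≡ 0
zero-unless true  = refl
zero-unless false = refl

unless-monoˡ : ∀ b {x y} → x ≤ y → x unless b ≤ y unless b
unless-monoˡ true  x≤y = z≤n
unless-monoˡ false x≤y = x≤y

-- The left side is the form to which `count` unfolds on a nonempty vector; the right side is
-- additive, with a first term that `sum-δ` evaluates after summation.
suc-unless : ∀ c d x →
  (if d then suc else id) x unless c ≡ (if d then ⟦ not c ⟧ else 0) + x unless c
suc-unless true  true  x = refl
suc-unless true  false x = refl
suc-unless false true  x = refl
suc-unless false false x = refl

-- Turns a claim about a single edge into a truth table over the memberships of its two ends,
-- settled by `toWitness`.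
all-Bool? : {P : Bool → Set} → (∀ b → Dec (P b)) → Dec (∀ b → P b)
all-Bool? P? = map′ (λ { (f , t) false → f ; (f , t) true → t }) (λ h → h false , h true)
                    (P? false ×-dec P? true)

sum-mono : {f g : Fin n → ℕ} → (∀ i → f i ≤ g i) → sum f ≤ sum g
sum-mono {zero}  f≤g = z≤n
sum-mono {suc n} f≤g = ℕ.+-mono-≤ (f≤g zero) (sum-mono (f≤g ∘ suc))

sum-zero : {f : Fin n → ℕ} → (∀ i → f i ≡ 0) → sum f ≡ 0
sum-zero {n} f≡0 = trans (sum-cong-≗ f≡0) (sum-replicate-zero n)

sum-+ : (f g : Fin n → ℕ) → sum (λ i → f i + g i) ≡ sum f + sum g
sum-+ = ∑-distrib-+

sum-one : ∀ n → sum {n} (const 1) ≡ n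
sum-one zero    = refl
sum-one (suc n) = cong suc (sum-one n)

sum-δ : (g : Fin n → ℕ) (x : Fin n) → sum (λ v → if does (v Fin.≟ x) then g v else 0) ≡ g x
sum-δ {suc n} g zero = trans (cong₂ _+_ refl (sum-replicate-zero n)) (ℕ.+-identityʳ _)
sum-δ g (suc x) = sum-δ (g ∘ suc) x

-- One strict term would make `sum g` too small. This is how a labeling of large enough height is
-- seen to exhaust every capacity.
sum-squeeze : {f g : Fin n → ℕ} → (∀ i → g i ≤ f i) → sum f ≤ sum g → ∀ i → f i ≤ g i
sum-squeeze {suc n} {f} {g} g≤f Σf≤Σg zero = ℕ.+-cancelʳ-≤ (sum (f ∘ suc)) _ _
  (ℕ.≤-trans Σf≤Σg (ℕ.+-monoʳ-≤ (g zero) (sum-mono (g≤f ∘ suc))))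
sum-squeeze {suc n} {f} {g} g≤f Σf≤Σg (suc i) = sum-squeeze (g≤f ∘ suc)
  (ℕ.+-cancelˡ-≤ (f zero) _ _ (ℕ.≤-trans Σf≤Σg (ℕ.+-monoˡ-≤ _ (g≤f zero)))) i

sum-unless-split : (b : Fin n → Bool) (f : Fin n → ℕ) →
  sum f ≡ sum (λ v → f v unless b v) + sum (λ v → f v unless not (b v))
sum-unless-split b f = trans (sum-cong-≗ λ v → split (b v) (f v)) (sum-+ (λ v → f v unless b v) (λ v → f v unless not (b v)))
  where
  split : ∀ c x → x ≡ x unless c + x unless not c
  split true  x = refl
  split false x = sym (ℕ.+-identityʳ x)

-- Double counting: each index `e` is counted at exactly one vertex, namely `f e`.
sum-unless-count : (b : Fin n → Bool) (f : Fin k → Fin n) →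
  sum (λ v → count (v Fin.≟_) (tabulate f) unless b v) ≡ sum (λ e → ⟦ not (b (f e)) ⟧)
sum-unless-count {k = zero}  b f = sum-zero λ v → zero-unless (b v)
sum-unless-count {k = suc k} b f = begin
  sum (λ v → count (v Fin.≟_) (tabulate f) unless b v)
    ≡⟨ sum-cong-≗ (λ v → suc-unless (b v) (does (v Fin.≟ f zero)) _) ⟩
  sum (λ v → (if does (v Fin.≟ f zero) then ⟦ not (b v) ⟧ else 0)
             + count (v Fin.≟_) (tabulate (f ∘ suc)) unless b v)
    ≡⟨ sum-+ (λ v → if does (v Fin.≟ f zero) then ⟦ not (b v) ⟧ else 0)
             (λ v → count (v Fin.≟_) (tabulate (f ∘ suc)) unless b v) ⟩
  sum (λ v → if does (v Fin.≟ f zero) then ⟦ not (b v) ⟧ else 0)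
    + sum (λ v → count (v Fin.≟_) (tabulate (f ∘ suc)) unless b v)
    ≡⟨ cong₂ _+_ (sum-δ (λ v → ⟦ not (b v) ⟧) (f zero)) (sum-unless-count b (f ∘ suc)) ⟩
  sum (λ e → ⟦ not (b (f e)) ⟧) ∎
  where
  open ≡-Reasoning

-- Enumerating the positions counted by count

nth : ∀ {A : Set} {P : Pred A Level.zero} (P? : Decidable P) (xs : Vec A k) →
      Σ[ f ∈ (Fin (count P? xs) → Fin k) ] (∀ j → P (lookup xs (f j))) × Injective _≡_ _≡_ f
nth P? []       = (λ ()) , (λ ()) , λ { {()} }
nth P? (x ∷ xs) with P? x | nth P? xs
... | no _  | f , Pf , f-inj = suc ∘ f , Pf , f-inj ∘ Fin.suc-injective
... | yes p | f , Pf , f-inj = g , Pg , g-inj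
  where
  g = λ { zero → zero ; (suc j) → suc (f j) }
  Pg = λ { zero → p ; (suc j) → Pf j }
  g-inj : Injective _≡_ _≡_ g
  g-inj {zero}  {zero}  eq = refl
  g-inj {zero}  {suc _} ()
  g-inj {suc _} {zero}  ()
  g-inj {suc _} {suc _} eq = cong suc (f-inj (Fin.suc-injective eq))

-- The reverse of `nth`. Together they carry injections between subsets to injections between
-- `Fin`s, where the pigeonhole principle is available.
position : ∀ {A : Set} {P : Pred A Level.zero} (P? : Decidable P) (xs : Vec A k) →
           Σ[ f ∈ (∀ i → P (lookup xs i) → Fin (count P? xs)) ]
             (∀ {i i′ q q′} → f i q ≡ f i′ q′ → i ≡ i′)
position P? []       = (λ ()) , λ { {()} }
position {P = P} P? (x ∷ xs) with P? x | position P? xs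
... | yes p | f , f-inj = g , g-inj
  where
  g : ∀ i → P (lookup (x ∷ xs) i) → Fin (suc (count P? xs))
  g zero    _ = zero
  g (suc i) q = suc (f i q)
  g-inj : ∀ {i i′ q q′} → g i q ≡ g i′ q′ → i ≡ i′
  g-inj {zero}  {zero}  eq = refl
  g-inj {zero}  {suc _} ()
  g-inj {suc _} {zero}  ()
  g-inj {suc _} {suc _} eq = cong suc (f-inj (Fin.suc-injective eq))
... | no ¬p | f , f-inj = g , g-inj
  where
  g : ∀ i → P (lookup (x ∷ xs) i) → Fin (count P? xs)
  g zero    q = contradiction q ¬p
  g (suc i) q = f i q
  g-inj : ∀ {i i′ q q′} → g i q ≡ g i′ q′ → i ≡ i′
  g-inj {zero}          {q = q}   eq = contradiction q ¬p
  g-inj {suc _} {zero}  {q′ = q′} eq = contradiction q′ ¬p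
  g-inj {suc _} {suc _}           eq = cong suc (f-inj eq)

_inside? : Decidable (_≡ inside)
true  inside? = yes refl
false inside? = no λ ()

∣p∣≡count : (p : Subset n) → ∣ p ∣ ≡ count _inside? p
∣p∣≡count []          = refl
∣p∣≡count (true  ∷ p) = cong suc (∣p∣≡count p)
∣p∣≡count (false ∷ p) = ∣p∣≡count p

injection⇒∣p∣≤∣q∣ : (p : Subset k) (q : Subset n) (f : ∃ (_∈ p) → Fin n) →
                    (∀ x → f x ∈ q) → Injective _≡_ _≡_ f → ∣ p ∣ ≤ ∣ q ∣
injection⇒∣p∣≤∣q∣ {k} {n} p q f f∈q f-inj rewrite ∣p∣≡count p | ∣p∣≡count q = injective⇒≤ {f = g} g-inj
  where
  element : Fin (count _inside? p) → ∃ (_∈ p)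
  element j = let h , h∈p , _ = nth _inside? p in h j , lookup⇒[]= (h j) p (h∈p j)

  g : Fin (count _inside? p) → Fin (count _inside? q)
  g j = proj₁ (position _inside? q) (f (element j)) ([]=⇒lookup (f∈q (element j)))

  g-inj : Injective _≡_ _≡_ g
  g-inj eq = proj₂ (proj₂ (nth _inside? p)) (cong proj₁ (f-inj (proj₂ (position _inside? q) eq)))

∣tabulate∣ : (b : Fin n → Bool) → ∣ tabulate b ∣ ≡ sum (λ i → ⟦ b i ⟧)
∣tabulate∣ {zero}  b = refl
∣tabulate∣ {suc n} b with b zero
... | true  = cong suc (∣tabulate∣ (b ∘ suc))
... | false = ∣tabulate∣ (b ∘ suc)

lookup-extensional : {A : Set} {xs ys : Vec A n} → (∀ i → lookup xs i ≡ lookup ys i) → xs ≡ ys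
lookup-extensional {xs = xs} {ys} eq =
  trans (sym (tabulate∘lookup xs)) (trans (tabulate-cong eq) (tabulate∘lookup ys))

-- Subsets of a disjoint union

module _ (d : Fin n → ℕ) where

  -- `α G X v` is by definition the size of `slice (deg G) X v`.
  slice : Subset (total d) → (v : Fin n) → Subset (d v)
  slice X v = tabulate (λ i → lookup X (pair d v i))

  lookup-slice : ∀ X v i → lookup (slice X v) i ≡ lookup X (pair d v i)
  lookup-slice X v i = lookup∘tabulate _ i

  ∈-slice⁺ : ∀ {X v i} → pair d v i ∈ X → i ∈ slice X v
  ∈-slice⁺ {X} {v} {i} p = lookup⇒[]= i _ (trans (lookup-slice X v i) ([]=⇒lookup p))

  ∈-slice⁻ : ∀ {X v i} → i ∈ slice X v → pair d v i ∈ X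
  ∈-slice⁻ {X} {v} {i} p = lookup⇒[]= _ X (trans (sym (lookup-slice X v i)) ([]=⇒lookup p))

  slice-∪ : ∀ X Y v → slice (X ∪ Y) v ≡ slice X v ∪ slice Y v
  slice-∪ X Y v = lookup-extensional λ i → begin
    lookup (slice (X ∪ Y) v) i                     ≡⟨ lookup-slice (X ∪ Y) v i ⟩
    lookup (X ∪ Y) (pair d v i)                    ≡⟨ lookup-zipWith _∨_ (pair d v i) X Y ⟩
    lookup X (pair d v i) ∨ lookup Y (pair d v i)  ≡⟨ cong₂ _∨_ (lookup-slice X v i) (lookup-slice Y v i) ⟨
    lookup (slice X v) i ∨ lookup (slice Y v) i    ≡⟨ lookup-zipWith _∨_ i (slice X v) (slice Y v) ⟨
    lookup (slice X v ∪ slice Y v) i               ∎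
    where open ≡-Reasoning

  slice-∩ : ∀ X Y v → slice (X ∩ Y) v ≡ slice X v ∩ slice Y v
  slice-∩ X Y v = lookup-extensional λ i → begin
    lookup (slice (X ∩ Y) v) i                     ≡⟨ lookup-slice (X ∩ Y) v i ⟩
    lookup (X ∩ Y) (pair d v i)                    ≡⟨ lookup-zipWith _∧_ (pair d v i) X Y ⟩
    lookup X (pair d v i) ∧ lookup Y (pair d v i)  ≡⟨ cong₂ _∧_ (lookup-slice X v i) (lookup-slice Y v i) ⟨
    lookup (slice X v) i ∧ lookup (slice Y v) i    ≡⟨ lookup-zipWith _∧_ i (slice X v) (slice Y v) ⟨
    lookup (slice X v ∩ slice Y v) i               ∎
    where open ≡-Reasoning

∣p∣-splitAt : ∀ a {b} (X : Subset (a + b)) →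
  ∣ X ∣ ≡ ∣ tabulate (λ i → lookup X (i ↑ˡ b)) ∣ + ∣ tabulate (λ i → lookup X (a ↑ʳ i)) ∣
∣p∣-splitAt zero    X           = cong ∣_∣ (sym (tabulate∘lookup X))
∣p∣-splitAt (suc a) (true  ∷ X) = cong suc (∣p∣-splitAt a X)
∣p∣-splitAt (suc a) (false ∷ X) = ∣p∣-splitAt a X

∣X∣≡∑∣slice∣ : (d : Fin n → ℕ) (X : Subset (total d)) → ∣ X ∣ ≡ sum (λ v → ∣ slice d X v ∣)
∣X∣≡∑∣slice∣ {zero}  d []  = refl
∣X∣≡∑∣slice∣ {suc n} d X = begin
  ∣ X ∣
    ≡⟨ ∣p∣-splitAt (d zero) X ⟩
  ∣ slice d X zero ∣ + ∣ X′ ∣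
    ≡⟨ cong₂ _+_ refl (∣X∣≡∑∣slice∣ (d ∘ suc) X′) ⟩
  ∣ slice d X zero ∣ + sum (λ v → ∣ slice (d ∘ suc) X′ v ∣)
    ≡⟨ cong₂ _+_ refl
         (sum-cong-≗ λ v → cong ∣_∣ (tabulate-cong λ i → lookup∘tabulate _ (pair (d ∘ suc) v i))) ⟩
  sum (λ v → ∣ slice d X v ∣) ∎
  where
  open ≡-Reasoning
  X′ : Subset (total (d ∘ suc))
  X′ = tabulate (λ t → lookup X (d zero ↑ʳ t))

-- Labelings and covers

-- W is a set of vertices, F the set of the edges that may receive a label different from ∞.
module _ {n k : ℕ} (ends : Fin k → Fin n × Fin n) where

  -- Having `ends` as the parameter lets an induction drop the first edge by passing to
  -- `ends ∘ suc`. By eta, `toGraph` of the ends of `G` is `G` itself.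
  toGraph : Graph
  toGraph = record { ∣V∣ = n ; ∣E∣ = k ; ends = ends }

  touches : (Fin n → Bool) → Fin k → Bool
  touches W e = W (proj₁ (ends e)) ∨ W (proj₂ (ends e))

  weight : (m : Fin n → ℕ) (W : Fin n → Bool) → ℕ
  weight m W = sum (λ v → m v unless W v)

  covered : (F : Fin k → Bool) (W : Fin n → Bool) → ℕ
  covered F W = sum (λ e → ⟦ F e ∧ touches W e ⟧)

  -- A cut capacity in the network that leads from a source through the edges in `F` (capacity 1) to
  -- their ends and on to a sink (capacity `m v`).
  cost : (F : Fin k → Bool) (m : Fin n → ℕ) (W : Fin n → Bool) → ℕ
  cost F m W = weight m W + covered F W

  SupportedBy : (Fin k → Bool) → EdgeMap toGraph → Set
  SupportedBy F φ = ∀ e v → lookup φ e ≡ just v → F e ≡ true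

  IsEnd : Fin n → Fin k → Set
  IsEnd v e = v ≡ proj₁ (ends e) ⊎ v ≡ proj₂ (ends e)

  touches-end : ∀ W {v e} → IsEnd v e → W v ≡ true → touches W e ≡ true
  touches-end W (inj₁ refl) eq rewrite eq = refl
  touches-end W (inj₂ refl) eq rewrite eq = ∨-zeroʳ _

  label-end : ∀ {m} φ → IsLabeling toGraph m φ → ∀ e {v} → lookup φ e ≡ just v → IsEnd v e
  label-end φ (ends-ok , _) e eq with ends-ok e
  ... | inj₁ p        = inj₁ (just-injective (trans (sym eq) p))
  ... | inj₂ (inj₁ p) = inj₂ (just-injective (trans (sym eq) p))
  ... | inj₂ (inj₂ p) with () ← trans (sym eq) p

-- Charge an edge labeled `u` to the fibre of `u` if `u` is outside `W`, and otherwise to the edge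
-- itself, which then lies in `F` and touches `W`. With the fibre sizes as capacities, the empty `W`
-- bounds the height by their sum.
Hei≤cost : ∀ {n k} (ends : Fin k → Fin n × Fin n) F φ W →
  (∀ e {v} → lookup φ e ≡ just v → IsEnd ends v e) → SupportedBy ends F φ →
  Hei (toGraph ends) φ ≤ cost ends F (fibreSize (toGraph ends) φ) W
Hei≤cost {k = zero}  ends F []          W end supp = z≤n
Hei≤cost {k = suc k} ends F (nothing ∷ φ) W end supp = ℕ.≤-trans
  (Hei≤cost (ends ∘ suc) (F ∘ suc) φ W (λ e → end (suc e)) (λ e → supp (suc e)))
  (ℕ.+-monoʳ-≤ (weight ends (fibreSize (toGraph (ends ∘ suc)) φ) W) (ℕ.m≤n+m _ _))
Hei≤cost {n} {suc k} ends F (just u ∷ φ) W end supp = begin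
  suc (Hei (toGraph ends′) φ)
    ≤⟨ ℕ.+-mono-≤ one≤ (Hei≤cost ends′ (F ∘ suc) φ W (λ e → end (suc e)) (λ e → supp (suc e))) ⟩
  (⟦ not (W u) ⟧ + ⟦ F zero ∧ touches ends W zero ⟧)
    + (weight ends′ (fibreSize (toGraph ends′) φ) W + covered ends′ (F ∘ suc) W)
    ≡⟨ rearrange ⟦ not (W u) ⟧ _ (weight ends′ (fibreSize (toGraph ends′) φ) W) _ ⟩
  (⟦ not (W u) ⟧ + weight ends′ (fibreSize (toGraph ends′) φ) W) + covered ends F W
    ≡⟨ cong (λ s → s + weight ends′ (fibreSize (toGraph ends′) φ) W + covered ends F W) (sum-δ (λ v → ⟦ not (W v) ⟧) u) ⟨
  sum δ + weight ends′ (fibreSize (toGraph ends′) φ) W + covered ends F W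
    ≡⟨ cong (_+ covered ends F W) (sum-+ δ _) ⟨
  sum (λ v → δ v + fibreSize (toGraph ends′) φ v unless W v) + covered ends F W
    ≡⟨ cong (_+ covered ends F W) (sum-cong-≗ λ v → suc-unless (W v) (does (v Fin.≟ u)) (fibreSize (toGraph ends′) φ v)) ⟨
  cost ends F (fibreSize (toGraph ends) (just u ∷ φ)) W ∎
  where
  open ℕ.≤-Reasoning
  ends′ : Fin k → Fin n × Fin n
  ends′ = ends ∘ suc

  δ : Fin n → ℕ
  δ v = if does (v Fin.≟ u) then ⟦ not (W v) ⟧ else 0


  rearrange : ∀ a b c d → a + b + (c + d) ≡ a + c + (b + d)
  rearrange = solve-∀

  one≤ : 1 ≤ ⟦ not (W u) ⟧ + ⟦ F zero ∧ touches ends W zero ⟧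
  one≤ with W u in eq
  ... | false = s≤s z≤n
  ... | true rewrite supp zero u refl | touches-end ends W (end zero refl) eq = s≤s z≤n

module _ {n k : ℕ} (ends : Fin k → Fin n × Fin n) where

  -- An edge touching the union touches one of the two sets, and an edge touching the intersection
  -- touches both.
  covered-submodular : ∀ F W₁ W₂ →
    covered ends F (λ v → W₁ v ∨ W₂ v) + covered ends F (λ v → W₁ v ∧ W₂ v)
      ≤ covered ends F W₁ + covered ends F W₂
  covered-submodular F W₁ W₂ = begin
    covered ends F (λ v → W₁ v ∨ W₂ v) + covered ends F (λ v → W₁ v ∧ W₂ v)
      ≡⟨ sum-+ (λ e → ⟦ F e ∧ touches ends (λ v → W₁ v ∨ W₂ v) e ⟧) _ ⟨
    sum (λ e → ⟦ F e ∧ touches ends (λ v → W₁ v ∨ W₂ v) e ⟧ + ⟦ F e ∧ touches ends (λ v → W₁ v ∧ W₂ v) e ⟧)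
      ≤⟨ sum-mono (λ e → bools (F e) (W₁ (proj₁ (ends e))) (W₁ (proj₂ (ends e)))
                               (W₂ (proj₁ (ends e))) (W₂ (proj₂ (ends e)))) ⟩
    sum (λ e → ⟦ F e ∧ touches ends W₁ e ⟧ + ⟦ F e ∧ touches ends W₂ e ⟧)
      ≡⟨ sum-+ (λ e → ⟦ F e ∧ touches ends W₁ e ⟧) _ ⟩
    covered ends F W₁ + covered ends F W₂ ∎
    where
    open ℕ.≤-Reasoning
    bools : ∀ f a b c d →
      ⟦ f ∧ ((a ∨ c) ∨ (b ∨ d)) ⟧ + ⟦ f ∧ ((a ∧ c) ∨ (b ∧ d)) ⟧ ≤ ⟦ f ∧ (a ∨ b) ⟧ + ⟦ f ∧ (c ∨ d) ⟧
    bools = toWitness {a? = all-Bool? λ f → all-Bool? λ a → all-Bool? λ b → all-Bool? λ c →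
                            all-Bool? λ d → _ ℕ.≤? _} tt

  -- Four separate capacities make this serve both a fixed `m` and the vectors of `X`, `Y`, their
  -- union and their intersection. At a vertex in exactly one of `W₁`, `W₂`, only `m∩` survives on
  -- the left, and the last two hypotheses bound it.
  cost-submodular : ∀ F {m₁ m₂ m∪ m∩ : Fin n → ℕ} W₁ W₂ →
    (∀ v → m∪ v + m∩ v ≤ m₁ v + m₂ v) → (∀ v → m∩ v ≤ m₁ v) → (∀ v → m∩ v ≤ m₂ v) →
    cost ends F m∪ (λ v → W₁ v ∨ W₂ v) + cost ends F m∩ (λ v → W₁ v ∧ W₂ v)
      ≤ cost ends F m₁ W₁ + cost ends F m₂ W₂
  cost-submodular F {m₁} {m₂} {m∪} {m∩} W₁ W₂ mod ∩≤₁ ∩≤₂ = begin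
    cost ends F m∪ (λ v → W₁ v ∨ W₂ v) + cost ends F m∩ (λ v → W₁ v ∧ W₂ v)
      ≡⟨ rearrange (weight ends m∪ (λ v → W₁ v ∨ W₂ v)) _ (weight ends m∩ (λ v → W₁ v ∧ W₂ v)) _ ⟩
    (weight ends m∪ (λ v → W₁ v ∨ W₂ v) + weight ends m∩ (λ v → W₁ v ∧ W₂ v))
      + (covered ends F (λ v → W₁ v ∨ W₂ v) + covered ends F (λ v → W₁ v ∧ W₂ v))
      ≤⟨ ℕ.+-mono-≤ weights (covered-submodular F W₁ W₂) ⟩
    (weight ends m₁ W₁ + weight ends m₂ W₂) + (covered ends F W₁ + covered ends F W₂)
      ≡⟨ rearrange (weight ends m₁ W₁) _ (covered ends F W₁) _ ⟩
    cost ends F m₁ W₁ + cost ends F m₂ W₂ ∎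
    where
    open ℕ.≤-Reasoning
    rearrange : ∀ a b c d → a + b + (c + d) ≡ a + c + (b + d)
    rearrange = solve-∀

    pointwise : ∀ a b {x y z w} → x + y ≤ z + w → y ≤ z → y ≤ w →
                x unless (a ∨ b) + y unless (a ∧ b) ≤ z unless a + w unless b
    pointwise true  true  h₁ h₂ h₃ = z≤n
    pointwise true  false h₁ h₂ h₃ = h₃
    pointwise false true  h₁ h₂ h₃ = ℕ.≤-trans h₂ (ℕ.≤-reflexive (sym (ℕ.+-identityʳ _)))
    pointwise false false h₁ h₂ h₃ = h₁

    weights : weight ends m∪ (λ v → W₁ v ∨ W₂ v) + weight ends m∩ (λ v → W₁ v ∧ W₂ v)
                ≤ weight ends m₁ W₁ + weight ends m₂ W₂
    weights = begin
      weight ends m∪ (λ v → W₁ v ∨ W₂ v) + weight ends m∩ (λ v → W₁ v ∧ W₂ v)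
        ≡⟨ sum-+ (λ v → m∪ v unless (W₁ v ∨ W₂ v)) _ ⟨
      sum (λ v → m∪ v unless (W₁ v ∨ W₂ v) + m∩ v unless (W₁ v ∧ W₂ v))
        ≤⟨ sum-mono (λ v → pointwise (W₁ v) (W₂ v) (mod v) (∩≤₁ v) (∩≤₂ v)) ⟩
      sum (λ v → m₁ v unless W₁ v + m₂ v unless W₂ v)
        ≡⟨ sum-+ (λ v → m₁ v unless W₁ v) _ ⟩
      weight ends m₁ W₁ + weight ends m₂ W₂ ∎

  cost-monoᵐ : ∀ F {m m′} W → (∀ v → m v ≤ m′ v) → cost ends F m W ≤ cost ends F m′ W
  cost-monoᵐ F W m≤m′ = ℕ.+-monoˡ-≤ (covered ends F W) (sum-mono λ v → unless-monoˡ (W v) (m≤m′ v))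

  weak-duality : ∀ F {m} φ W → IsLabeling (toGraph ends) m φ → SupportedBy ends F φ →
                 Hei (toGraph ends) φ ≤ cost ends F m W
  weak-duality F φ W lab supp = ℕ.≤-trans
    (Hei≤cost ends F φ W (λ e → label-end ends φ lab e) supp) (cost-monoᵐ F W (proj₂ lab))

  -- The min-max theorem, by induction on the edges

  record MinMax (F : Fin k → Bool) (m : Fin n → ℕ) : Set where
    constructor minMax
    field
      φ          : EdgeMap (toGraph ends)
      isLabeling : IsLabeling (toGraph ends) m φ
      supported  : SupportedBy ends F φ
      W          : Fin n → Bool
      tight      : cost ends F m W ≤ Hei (toGraph ends) φ

  open MinMax

  height : ∀ {F m} → MinMax F m → ℕ
  height o = Hei (toGraph ends) (φ o)

  decrement : Fin n → (Fin n → ℕ) → Fin n → ℕ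
  decrement v m u = m u ∸ (if does (u Fin.≟ v) then 1 else 0)

  -- The lost unit is felt only when `v` lies outside `W`.
  cost-decrement : ∀ F m v W → cost ends F m W ≤ ⟦ not (W v) ⟧ + cost ends F (decrement v m) W
  cost-decrement F m v W = begin
    cost ends F m W
      ≤⟨ ℕ.+-monoˡ-≤ (covered ends F W) (sum-mono λ u → pointwise (W u) (does (u Fin.≟ v)) (m u)) ⟩
    sum (λ u → δ u + decrement v m u unless W u) + covered ends F W
      ≡⟨ cong (λ s → s + covered ends F W) (sum-+ δ _) ⟩
    sum δ + weight ends (decrement v m) W + covered ends F W
      ≡⟨ ℕ.+-assoc (sum δ) _ _ ⟩
    sum δ + cost ends F (decrement v m) W
      ≡⟨ cong (λ s → s + cost ends F (decrement v m) W) (sum-δ (λ u → ⟦ not (W u) ⟧) v) ⟩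
    ⟦ not (W v) ⟧ + cost ends F (decrement v m) W ∎
    where
    open ℕ.≤-Reasoning
    δ : Fin n → ℕ
    δ u = if does (u Fin.≟ v) then ⟦ not (W u) ⟧ else 0

    pointwise : ∀ w d x → x unless w ≤ (if d then ⟦ not w ⟧ else 0) + (x ∸ (if d then 1 else 0)) unless w
    pointwise true  d     x = z≤n
    pointwise false true  x = ℕ.m≤n+m∸n x 1
    pointwise false false x = ℕ.≤-refl

  cost-remove : ∀ F m v W → m v ≡ 0 →
    cost ends F m (λ u → not (does (u Fin.≟ v)) ∧ W u) ≤ cost ends F m W
  cost-remove F m v W mv≡0 = ℕ.+-mono-≤
    (sum-mono pointwise)
    (sum-mono λ e → bools (F e) (W (proj₁ (ends e))) (W (proj₂ (ends e)))
                          (not (does (proj₁ (ends e) Fin.≟ v))) (not (does (proj₂ (ends e) Fin.≟ v))))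
    where
    pointwise : ∀ u → m u unless (not (does (u Fin.≟ v)) ∧ W u) ≤ m u unless W u
    pointwise u with u Fin.≟ v
    ... | yes refl rewrite mv≡0 = z≤n
    ... | no  _    = ℕ.≤-refl

    bools : ∀ f a b c d → ⟦ f ∧ ((c ∧ a) ∨ (d ∧ b)) ⟧ ≤ ⟦ f ∧ (a ∨ b) ⟧
    bools = toWitness {a? = all-Bool? λ f → all-Bool? λ a → all-Bool? λ b → all-Bool? λ c →
                            all-Bool? λ d → _ ℕ.≤? _} tt

  -- A labeling no lower than that of `o` which leaves a unit of capacity at `v` free for a further
  -- edge.
  Augmentation : ∀ F m → MinMax F m → Fin n → Set
  Augmentation F m o v = Σ[ φ′ ∈ EdgeMap (toGraph ends) ]
    IsLabeling (toGraph ends) (decrement v m) φ′ × SupportedBy ends F φ′ ×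
    1 ≤ m v × height o ≤ Hei (toGraph ends) φ′

  -- Compare with the optimum `o′` for one unit less at `v`. If it is no lower, that unit is spare.
  -- If it is lower, its cover cannot contain `v`, since it would then cost the same under `m` and
  -- contradict weak duality for `o`; so it avoids `v` and costs at most one more under `m`. If
  -- `m v` is zero, `v` can be deleted from the cover of `o`.
  augment-or-avoid : ∀ F m (o : MinMax F m) v → MinMax F (decrement v m) →
    Augmentation F m o v ⊎ (∃[ W ] W v ≡ false × cost ends F m W ≤ height o)
  augment-or-avoid F m o v o′ with m v in mv≡
  ... | zero  = inj₂ (_ , removed , ℕ.≤-trans (cost-remove F m v (W o) mv≡) (tight o))
    where
    removed : not (does (v Fin.≟ v)) ∧ W o v ≡ false
    removed with v Fin.≟ v
    ... | yes _   = refl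
    ... | no v≢v = contradiction refl v≢v
  ... | suc _ with height o ℕ.≤? height o′
  ...   | yes h≤h′ = inj₁ (φ o′ , isLabeling o′ , supported o′ , s≤s z≤n , h≤h′)
  ...   | no  h≰h′ with W o′ v in Wv≡ | cost-decrement F m v (W o′)
  ...     | true  | c≤ = contradiction
    (ℕ.≤-trans (weak-duality F (φ o) (W o′) (isLabeling o) (supported o)) (ℕ.≤-trans c≤ (tight o′))) h≰h′
  ...     | false | c≤ = inj₂ (W o′ , Wv≡ , ℕ.≤-trans c≤ (ℕ.≤-trans (s≤s (tight o′)) (ℕ.≰⇒> h≰h′)))

  -- If neither end of a further edge can be used to augment, then intersecting the two optimal
  -- covers that avoid them gives an optimal cover that the edge does not touch.
  avoid-both : ∀ F m (o : MinMax F m) W₁ W₂ →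
    cost ends F m W₁ ≤ height o → cost ends F m W₂ ≤ height o →
    cost ends F m (λ v → W₁ v ∧ W₂ v) ≤ height o
  avoid-both F m o W₁ W₂ c₁ c₂ = ℕ.+-cancelˡ-≤ (height o) _ _ (begin
    height o + cost ends F m (λ v → W₁ v ∧ W₂ v)
      ≤⟨ ℕ.+-monoˡ-≤ _ (weak-duality F (φ o) (λ v → W₁ v ∨ W₂ v) (isLabeling o) (supported o)) ⟩
    cost ends F m (λ v → W₁ v ∨ W₂ v) + cost ends F m (λ v → W₁ v ∧ W₂ v)
      ≤⟨ cost-submodular F W₁ W₂ (λ _ → ℕ.≤-refl) (λ _ → ℕ.≤-refl) (λ _ → ℕ.≤-refl) ⟩
    cost ends F m W₁ + cost ends F m W₂
      ≤⟨ ℕ.+-mono-≤ c₁ c₂ ⟩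
    height o + height o ∎)
    where open ℕ.≤-Reasoning

-- The new edge takes the spare unit at `v`. The old cover stays optimal, because the new edge
-- raises both its cost by at most one and the height by one.
extend : ∀ {n k} (ends : Fin (suc k) → Fin n × Fin n) F m v → IsEnd ends v zero → F zero ≡ true →
  (o : MinMax (ends ∘ suc) (F ∘ suc) m) → Augmentation (ends ∘ suc) (F ∘ suc) m o v → MinMax ends F m
extend {n} {k} ends F m v v-end Fz o (φ′ , (φ′-ends , φ′-fibres) , φ′-supp , mv>0 , h≤) = record
  { φ          = just v ∷ φ′
  ; isLabeling = (λ { zero → label-ok v-end ; (suc e) → φ′-ends e }) , fibres
  ; supported  = λ { zero u eq → Fz ; (suc e) u eq → φ′-supp e u eq }
  ; W          = MinMax.W o
  ; tight      = begin
      cost ends F m (MinMax.W o)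
        ≡⟨ rearrange (weight ends m (MinMax.W o)) ⟦ F zero ∧ touches ends (MinMax.W o) zero ⟧ _ ⟩
      ⟦ F zero ∧ touches ends (MinMax.W o) zero ⟧ + cost (ends ∘ suc) (F ∘ suc) m (MinMax.W o)
        ≤⟨ ℕ.+-mono-≤ (⟦⟧≤1 (F zero ∧ touches ends (MinMax.W o) zero)) (ℕ.≤-trans (MinMax.tight o) h≤) ⟩
      suc (Hei (toGraph (ends ∘ suc)) φ′) ∎
  }
  where
  open ℕ.≤-Reasoning
  rearrange : ∀ a b c → a + (b + c) ≡ b + (a + c)
  rearrange = solve-∀

  ⟦⟧≤1 : ∀ b → ⟦ b ⟧ ≤ 1
  ⟦⟧≤1 true  = s≤s z≤n
  ⟦⟧≤1 false = z≤n

  label-ok : ∀ {x y} → v ≡ x ⊎ v ≡ y → just v ≡ just x ⊎ just v ≡ just y ⊎ just v ≡ nothing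
  label-ok (inj₁ refl) = inj₁ refl
  label-ok (inj₂ refl) = inj₂ (inj₁ refl)

  fibres : ∀ u → (if does (u Fin.≟ v) then suc else id) (fibreSize (toGraph (ends ∘ suc)) φ′ u) ≤ m u
  fibres u with u Fin.≟ v | φ′-fibres u
  ... | no  _    | h = h
  -- Truncated subtraction is exact here because `m v` is positive.
  ... | yes refl | h = ℕ.≤-trans (s≤s h) (ℕ.≤-reflexive (ℕ.m+[n∸m]≡n mv>0))

könig : ∀ {n k} (ends : Fin k → Fin n × Fin n) F m → MinMax ends F m
könig {k = zero} ends F m = record
  { φ = [] ; isLabeling = (λ ()) , (λ _ → z≤n) ; supported = λ ()
  -- Without edges, the set of all vertices costs nothing.
  ; W = const true ; tight = ℕ.≤-reflexive (cong (λ s → s + 0) (sum-zero {f = λ v → m v unless true} λ v → refl)) }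
könig {n} {suc k} ends F m = go (F zero) refl
  where
  G′ : Graph
  G′ = toGraph (ends ∘ suc)

  o : MinMax (ends ∘ suc) (F ∘ suc) m
  o = könig (ends ∘ suc) (F ∘ suc) m

  v w : Fin n
  v = proj₁ (ends zero)
  w = proj₂ (ends zero)

  -- Leaving the new edge at ∞ is optimal once an optimal cover for the other edges is not charged
  -- for it.
  skip : ∀ W → cost (ends ∘ suc) (F ∘ suc) m W ≤ Hei G′ (MinMax.φ o) →
         F zero ∧ touches ends W zero ≡ false → MinMax ends F m
  skip W c≤ untouched = record
    { φ          = nothing ∷ MinMax.φ o
    ; isLabeling = (λ { zero → inj₂ (inj₂ refl) ; (suc e) → proj₁ (MinMax.isLabeling o) e })
                 , proj₂ (MinMax.isLabeling o)
    ; supported  = λ { zero u () ; (suc e) u eq → MinMax.supported o e u eq }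
    ; W          = W
    ; tight      = subst (λ b → weight ends m W + (⟦ b ⟧ + covered (ends ∘ suc) (F ∘ suc) W) ≤ Hei G′ (MinMax.φ o))
                         (sym untouched) c≤
    }

  go : ∀ b → F zero ≡ b → MinMax ends F m
  go false Fz = skip (MinMax.W o) (MinMax.tight o) (cong (λ b → b ∧ touches ends (MinMax.W o) zero) Fz)
  go true  Fz
    with augment-or-avoid (ends ∘ suc) (F ∘ suc) m o v (könig (ends ∘ suc) (F ∘ suc) _)
       | augment-or-avoid (ends ∘ suc) (F ∘ suc) m o w (könig (ends ∘ suc) (F ∘ suc) _)
  ... | inj₁ a | _      = extend ends F m v (inj₁ refl) Fz o a
  ... | inj₂ _ | inj₁ a = extend ends F m w (inj₂ refl) Fz o a
  ... | inj₂ (W₁ , W₁v , c₁) | inj₂ (W₂ , W₂w , c₂) =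
    skip (λ u → W₁ u ∧ W₂ u) (avoid-both (ends ∘ suc) (F ∘ suc) m o W₁ W₂ c₁ c₂) untouched
    where
    untouched : F zero ∧ ((W₁ v ∧ W₂ v) ∨ (W₁ w ∧ W₂ w)) ≡ false
    untouched rewrite W₁v | W₂w | ∧-zeroʳ (W₁ w) = ∧-zeroʳ (F zero)

∈-allVecs : {A : Set} {xs : List A} → (∀ x → x List.∈ xs) → (φ : Vec A k) → φ List.∈ allVecs xs k
∈-allVecs all []      = here refl
∈-allVecs all (x ∷ φ) = List.∈-cartesianProductWith⁺ _∷_ (all x) (∈-allVecs all φ)

every : Fin k → Bool
every = const true

-- The rank function

module _ (G : Graph) where
  open Graph G

  -- `r G X` is `+ ρ X` by definition, so the estimates can be made in ℕ.
  ρ : Subset (∣S∣ G) → ℕ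
  ρ X = max 0 (List.map (Hei G) (List.filter (isLabeling? G (α G X)) (edgeMaps G)))

  ∈-edgeMaps : ∀ φ → φ List.∈ edgeMaps G
  ∈-edgeMaps = ∈-allVecs λ { nothing → here refl ; (just v) → there (List.∈-map⁺ just (List.∈-allFin v)) }

  Hei≤ρ : ∀ X φ → IsLabeling G (α G X) φ → Hei G φ ≤ ρ X
  Hei≤ρ X φ lab = v≤max⁺ 0 _ (inj₂ (Any.map ℕ.≤-reflexive
    (List.∈-map⁺ (Hei G) (List.∈-filter⁺ (isLabeling? G (α G X)) (∈-edgeMaps φ) lab))))

  -- With `ρ-cover` this says that `ρ X` is the minimum of the costs; the later facts about `ρ` rest
  -- on these two.
  ρ≤cost : ∀ X W → ρ X ≤ cost ends every (α G X) W
  ρ≤cost X W = max≤v⁺ z≤n (All.map⁺ (All.map (λ {φ} lab → weak-duality ends every φ W lab (λ _ _ _ → refl))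
    (All.all-filter (isLabeling? G (α G X)) (edgeMaps G))))

  ρ-cover : ∀ X → ∃[ W ] cost ends every (α G X) W ≤ ρ X
  ρ-cover X = let minMax φ lab _ W tight = könig ends every (α G X) in
    W , ℕ.≤-trans tight (Hei≤ρ X φ lab)

  α-mono : ∀ {X Y} → X ⊆ Y → ∀ v → α G X v ≤ α G Y v
  α-mono X⊆Y v = p⊆q⇒∣p∣≤∣q∣ (∈-slice⁺ (deg G) ∘ X⊆Y ∘ ∈-slice⁻ (deg G))

  α-modular : ∀ X Y v → α G (X ∪ Y) v + α G (X ∩ Y) v ≡ α G X v + α G Y v
  α-modular X Y v rewrite slice-∪ (deg G) X Y v | slice-∩ (deg G) X Y v =
    ∣p∪q∣+∣p∩q∣ (slice (deg G) X v) (slice (deg G) Y v)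

  α-⊥ : ∀ v → α G ⊥ v ≡ 0
  α-⊥ v = ℕ.n≤0⇒n≡0 (ℕ.≤-trans
    (p⊆q⇒∣p∣≤∣q∣ {q = ⊥} λ i∈ → contradiction (∈-slice⁻ (deg G) i∈) ∉⊥)
    (ℕ.≤-reflexive (∣⊥∣≡0 (deg G v))))

  α-full : ∀ X v → (∀ i → pair (deg G) v i ∈ X) → α G X v ≡ deg G v
  α-full X v full = ℕ.≤-antisym (∣p∣≤n (slice (deg G) X v))
    (ℕ.≤-trans (ℕ.≤-reflexive (sym (∣⊤∣≡n (deg G v)))) (p⊆q⇒∣p∣≤∣q∣ {p = ⊤} λ {i} _ → ∈-slice⁺ (deg G) (full i)))

  α-empty : ∀ X v → (∀ i → pair (deg G) v i ∉ X) → α G X v ≡ 0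
  α-empty X v empty = ℕ.n≤0⇒n≡0 (ℕ.≤-trans
    (p⊆q⇒∣p∣≤∣q∣ {q = ⊥} λ {i} i∈ → contradiction (∈-slice⁻ (deg G) i∈) (empty i))
    (ℕ.≤-reflexive (∣⊥∣≡0 (deg G v))))

  α-─ : ∀ T X v → X ⊆ T → α G X v + α G (T ─ X) v ≡ α G T v
  α-─ T X v X⊆T = begin
    α G X v + α G (T ─ X) v                    ≡⟨ ℕ.+-comm (α G X v) _ ⟩
    α G (T ─ X) v + α G X v                    ≡⟨ α-modular (T ─ X) X v ⟨
    α G ((T ─ X) ∪ X) v + α G ((T ─ X) ∩ X) v  ≡⟨ cong₂ (λ A B → α G A v + α G B v) (p─q∪q≡p T X X⊆T) (p─q∩q≡⊥ T X) ⟩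
    α G T v + α G ⊥ v                          ≡⟨ cong (λ a → α G T v + a) (α-⊥ v) ⟩
    α G T v + 0                                ≡⟨ ℕ.+-identityʳ _ ⟩
    α G T v                                    ∎
    where open ≡-Reasoning

  ∣X∣≡∑α : ∀ X → ∣ X ∣ ≡ sum (α G X)
  ∣X∣≡∑α = ∣X∣≡∑∣slice∣ (deg G)

  ρ≤∣X∣ : ∀ X → ρ X ≤ ∣ X ∣
  -- The empty cover: no edge is charged, and the weight is the whole size of `X`.
  ρ≤∣X∣ X = ℕ.≤-trans (ρ≤cost X (const false)) (ℕ.≤-reflexive (begin
    sum (α G X) + sum {∣E∣} (const 0)  ≡⟨ cong (λ s → sum (α G X) + s) (sum-zero {f = λ (_ : E) → 0} λ _ → refl) ⟩
    sum (α G X) + 0                    ≡⟨ ℕ.+-identityʳ _ ⟩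
    sum (α G X)                        ≡⟨ ∣X∣≡∑α X ⟨
    ∣ X ∣                              ∎))
    where open ≡-Reasoning

  ρ-mono : ∀ {X Y} → X ⊆ Y → ρ X ≤ ρ Y
  ρ-mono {X} {Y} X⊆Y = let W , tight = ρ-cover Y in
    ℕ.≤-trans (ρ≤cost X W) (ℕ.≤-trans (cost-monoᵐ ends every W (α-mono X⊆Y)) tight)

  -- The union of optimal covers for `X` and `Y` is tested against `X ∪ Y`, their intersection
  -- against `X ∩ Y`.
  ρ-submodular : ∀ X Y → ρ (X ∪ Y) + ρ (X ∩ Y) ≤ ρ X + ρ Y
  ρ-submodular X Y = let W₁ , tight₁ = ρ-cover X ; W₂ , tight₂ = ρ-cover Y in begin
    ρ (X ∪ Y) + ρ (X ∩ Y)
      ≤⟨ ℕ.+-mono-≤ (ρ≤cost (X ∪ Y) _) (ρ≤cost (X ∩ Y) _) ⟩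
    cost ends every (α G (X ∪ Y)) (λ v → W₁ v ∨ W₂ v) + cost ends every (α G (X ∩ Y)) (λ v → W₁ v ∧ W₂ v)
      ≤⟨ cost-submodular ends every W₁ W₂ (λ v → ℕ.≤-reflexive (α-modular X Y v))
           (α-mono (p∩q⊆p X Y)) (α-mono (p∩q⊆q X Y)) ⟩
    cost ends every (α G X) W₁ + cost ends every (α G Y) W₂
      ≤⟨ ℕ.+-mono-≤ tight₁ tight₂ ⟩
    ρ X + ρ Y ∎
    where open ℕ.≤-Reasoning

  isRankFunction : ∀ T → IsRankFunction T (r G)
  isRankFunction T = record
    { nonNegative = λ _ _ → ℤ.+≤+ z≤n
    ; bounded     = λ X _ → ℤ.+≤+ (ρ≤∣X∣ X)
    ; monotone    = λ _ _ X⊆Y _ → ℤ.+≤+ (ρ-mono X⊆Y)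
    ; submodular  = λ X Y _ _ → ℤ.+≤+ (ρ-submodular X Y)
    }

  -- Complementary covers and self-duality

  weight-deg : ∀ W → weight ends (deg G) W ≡
    sum (λ e → ⟦ not (W (proj₁ (ends e))) ⟧ + ⟦ not (W (proj₂ (ends e))) ⟧)
  weight-deg W = begin
    weight ends (deg G) W
      ≡⟨ sum-cong-≗ (λ v → unless-distrib-+ (W v) _ _) ⟩
    sum (λ v → count (v Fin.≟_) (tabulate (proj₁ ∘ ends)) unless W v
             + count (v Fin.≟_) (tabulate (proj₂ ∘ ends)) unless W v)
      ≡⟨ sum-+ (λ v → count (v Fin.≟_) (tabulate (proj₁ ∘ ends)) unless W v) _ ⟩
    sum (λ v → count (v Fin.≟_) (tabulate (proj₁ ∘ ends)) unless W v)
      + sum (λ v → count (v Fin.≟_) (tabulate (proj₂ ∘ ends)) unless W v)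
      -- First and second ends are counted separately, so a loop counts twice, as in `deg`.
      ≡⟨ cong₂ _+_ (sum-unless-count W (proj₁ ∘ ends)) (sum-unless-count W (proj₂ ∘ ends)) ⟩
    sum (λ e → ⟦ not (W (proj₁ (ends e))) ⟧) + sum (λ e → ⟦ not (W (proj₂ (ends e))) ⟧)
      ≡⟨ sum-+ (λ e → ⟦ not (W (proj₁ (ends e))) ⟧) _ ⟨
    sum (λ e → ⟦ not (W (proj₁ (ends e))) ⟧ + ⟦ not (W (proj₂ (ends e))) ⟧) ∎
    where
    open ≡-Reasoning
    unless-distrib-+ : ∀ c x y → (x + y) unless c ≡ x unless c + y unless c
    unless-distrib-+ true  x y = refl
    unless-distrib-+ false x y = refl

  -- Outside `W` the two capacities add up to degrees, which count edge ends outside `W`. For each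
  -- edge, those ends plus one if it touches `W` make one plus one if it touches the complement.
  cost-complement : ∀ {m m′} W → (∀ v → m v + m′ v ≡ deg G v) →
    cost ends every m′ W + sum m ≡ ∣E∣ + cost ends every m (not ∘ W)
  cost-complement {m} {m′} W m+m′ = begin
    weight ends m′ W + covered ends every W + sum m
      ≡⟨ cong (λ s → weight ends m′ W + covered ends every W + s) (sum-unless-split W m) ⟩
    weight ends m′ W + covered ends every W + (weight ends m W + weight ends m (not ∘ W))
      ≡⟨ rearrange₁ (weight ends m′ W) (covered ends every W) (weight ends m W) _ ⟩
    weight ends m W + weight ends m′ W + covered ends every W + weight ends m (not ∘ W)
      ≡⟨ cong (λ s → s + covered ends every W + weight ends m (not ∘ W)) weights ⟩
    weight ends (deg G) W + covered ends every W + weight ends m (not ∘ W)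
      ≡⟨ cong (λ s → s + weight ends m (not ∘ W)) edges ⟩
    ∣E∣ + covered ends every (not ∘ W) + weight ends m (not ∘ W)
      ≡⟨ rearrange₂ ∣E∣ (covered ends every (not ∘ W)) _ ⟩
    ∣E∣ + cost ends every m (not ∘ W) ∎
    where
    open ≡-Reasoning
    rearrange₁ : ∀ a b c d → a + b + (c + d) ≡ c + a + b + d
    rearrange₁ = solve-∀

    rearrange₂ : ∀ a b c → a + b + c ≡ a + (c + b)
    rearrange₂ = solve-∀

    pointwise : ∀ c {x y z} → x + y ≡ z → x unless c + y unless c ≡ z unless c
    pointwise true  eq = refl
    pointwise false eq = eq

    weights : weight ends m W + weight ends m′ W ≡ weight ends (deg G) W
    weights = trans (sym (sum-+ (λ v → m v unless W v) _)) (sum-cong-≗ λ v → pointwise (W v) (m+m′ v))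

    bools : ∀ a b → ⟦ not a ⟧ + ⟦ not b ⟧ + ⟦ a ∨ b ⟧ ≡ 1 + ⟦ not a ∨ not b ⟧
    bools = toWitness {a? = all-Bool? λ a → all-Bool? λ b → _ ℕ.≟ _} tt

    edges : weight ends (deg G) W + covered ends every W ≡ ∣E∣ + covered ends every (not ∘ W)
    edges = begin
      weight ends (deg G) W + covered ends every W
        ≡⟨ cong (λ s → s + covered ends every W) (weight-deg W) ⟩
      sum (λ e → ⟦ not (W (proj₁ (ends e))) ⟧ + ⟦ not (W (proj₂ (ends e))) ⟧) + covered ends every W
        ≡⟨ sum-+ (λ e → ⟦ not (W (proj₁ (ends e))) ⟧ + ⟦ not (W (proj₂ (ends e))) ⟧) _ ⟨
      sum (λ e → ⟦ not (W (proj₁ (ends e))) ⟧ + ⟦ not (W (proj₂ (ends e))) ⟧ + ⟦ touches ends W e ⟧)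
        ≡⟨ sum-cong-≗ (λ e → bools (W (proj₁ (ends e))) (W (proj₂ (ends e)))) ⟩
      sum (λ e → 1 + ⟦ touches ends (not ∘ W) e ⟧)
        ≡⟨ sum-+ (λ _ → 1) (λ e → ⟦ touches ends (not ∘ W) e ⟧) ⟩
      sum {∣E∣} (const 1) + covered ends every (not ∘ W)
        ≡⟨ cong (λ s → s + covered ends every (not ∘ W)) (sum-one ∣E∣) ⟩
      ∣E∣ + covered ends every (not ∘ W) ∎

  cost-∁ : ∀ X W → cost ends every (α G (⊤ ─ X)) W + ∣ X ∣ ≡ ∣E∣ + cost ends every (α G X) (not ∘ W)
  cost-∁ X W = trans (cong (λ s → cost ends every (α G (⊤ ─ X)) W + s) (∣X∣≡∑α X))
    (cost-complement {α G X} {α G (⊤ ─ X)} W λ v → trans (α-─ ⊤ X v (⊆-max X)) (α-full ⊤ v λ _ → ∈⊤))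

  -- Both sides of `cost-∁` are minimised over `W`: an optimal cover for one side is complemented to
  -- bound the other.
  ρ-∁ : ∀ X → ρ (⊤ ─ X) + ∣ X ∣ ≡ ∣E∣ + ρ X
  ρ-∁ X = ℕ.≤-antisym
    (let W , tight = ρ-cover X in begin
      ρ (⊤ ─ X) + ∣ X ∣
        ≤⟨ ℕ.+-monoˡ-≤ ∣ X ∣ (ρ≤cost (⊤ ─ X) (not ∘ W)) ⟩
      cost ends every (α G (⊤ ─ X)) (not ∘ W) + ∣ X ∣
        ≡⟨ cost-∁ X (not ∘ W) ⟩
      ∣E∣ + cost ends every (α G X) (not ∘ not ∘ W)
        -- Complementing twice restores `W` only pointwise, so the sums are rewritten term by term.
        ≡⟨ cong (λ s → ∣E∣ + s) (cong₂ _+_ (sum-cong-≗ λ v → cong (λ b → α G X v unless b) (not-involutive (W v)))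
             (sum-cong-≗ λ e → cong ⟦_⟧ (cong₂ _∨_ (not-involutive (W (proj₁ (ends e)))) (not-involutive (W (proj₂ (ends e))))))) ⟩
      ∣E∣ + cost ends every (α G X) W
        ≤⟨ ℕ.+-monoʳ-≤ ∣E∣ tight ⟩
      ∣E∣ + ρ X ∎)
    (let W , tight = ρ-cover (⊤ ─ X) in begin
      ∣E∣ + ρ X
        ≤⟨ ℕ.+-monoʳ-≤ ∣E∣ (ρ≤cost X (not ∘ W)) ⟩
      ∣E∣ + cost ends every (α G X) (not ∘ W)
        ≡⟨ cost-∁ X W ⟨
      cost ends every (α G (⊤ ─ X)) W + ∣ X ∣
        ≤⟨ ℕ.+-monoˡ-≤ ∣ X ∣ tight ⟩
      ρ (⊤ ─ X) + ∣ X ∣ ∎)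
    where open ℕ.≤-Reasoning

  -- The case of the empty set in `ρ-∁`.
  ρ-⊤ : ρ ⊤ ≡ ∣E∣
  ρ-⊤ = begin
    ρ ⊤                  ≡⟨ cong ρ (p─⊥≡p ⊤) ⟨
    ρ (⊤ ─ ⊥)            ≡⟨ ℕ.+-identityʳ _ ⟨
    ρ (⊤ ─ ⊥) + 0        ≡⟨ cong (λ s → ρ (⊤ ─ ⊥) + s) (∣⊥∣≡0 (∣S∣ G)) ⟨
    ρ (⊤ ─ ⊥) + ∣ ⊥ {∣S∣ G} ∣  ≡⟨ ρ-∁ ⊥ ⟩
    ∣E∣ + ρ ⊥            ≡⟨ cong (λ s → ∣E∣ + s) (ℕ.n≤0⇒n≡0 (subst (ρ ⊥ ≤_) (∣⊥∣≡0 (∣S∣ G)) (ρ≤∣X∣ ⊥))) ⟩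
    ∣E∣ + 0              ≡⟨ ℕ.+-identityʳ _ ⟩
    ∣E∣                  ∎
    where open ≡-Reasoning

  selfDual : IdenticallySelfDual (matroid ⊤ (r G) (isRankFunction ⊤))
  selfDual = refl , λ X _ → begin
    + ∣ X ∣ ℤ.- + ρ ⊤ ℤ.+ + ρ (⊤ ─ X)    ≡⟨ rearrange₁ (+ ∣ X ∣) (+ ρ ⊤) (+ ρ (⊤ ─ X)) ⟩
    + (ρ (⊤ ─ X) + ∣ X ∣) ℤ.- + ρ ⊤      ≡⟨ cong₂ (λ a b → + a ℤ.- + b) (ρ-∁ X) ρ-⊤ ⟩
    (+ ∣E∣ ℤ.+ + ρ X) ℤ.- + ∣E∣          ≡⟨ rearrange₂ (+ ∣E∣) (+ ρ X) ⟩
    + ρ X                                ∎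
    where
    open ≡-Reasoning
    rearrange₁ : ∀ a b c → a ℤ.- b ℤ.+ c ≡ c ℤ.+ a ℤ.- b
    rearrange₁ = ℤ-solve-∀

    rearrange₂ : ∀ a b → a ℤ.+ b ℤ.- a ≡ b
    rearrange₂ = ℤ-solve-∀

  -- Transversal presentations

  vertex : Fin (∣S∣ G) → V
  vertex x = proj₁ (unpair (deg G) x)

  vertex-pair : ∀ v i → vertex (pair (deg G) v i) ≡ v
  vertex-pair v i = cong proj₁ (unpair-pair (deg G) v i)

  -- Edges outside `F` keep their index but get the empty set, so the index set is always `E`.
  family : Subset (∣S∣ G) → (E → Bool) → E → Subset (∣S∣ G)
  family T F e = T ∩ tabulate λ x →
    F e ∧ (does (vertex x Fin.≟ proj₁ (ends e)) ∨ does (vertex x Fin.≟ proj₂ (ends e)))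

  ∈-family⁺ : ∀ {T F e x} → x ∈ T → F e ≡ true → IsEnd ends (vertex x) e → x ∈ family T F e
  ∈-family⁺ {T} {F} {e} {x} x∈T Fe end =
    x∈p∩q⁺ (x∈T , lookup⇒[]= x _ (trans (lookup∘tabulate _ x) (cong₂ _∧_ Fe (is-end end))))
    where
    is-end : IsEnd ends (vertex x) e →
             does (vertex x Fin.≟ proj₁ (ends e)) ∨ does (vertex x Fin.≟ proj₂ (ends e)) ≡ true
    is-end (inj₁ eq) rewrite dec-true (vertex x Fin.≟ proj₁ (ends e)) eq = refl
    is-end (inj₂ eq) rewrite dec-true (vertex x Fin.≟ proj₂ (ends e)) eq = ∨-zeroʳ _

  ∈-family⁻ : ∀ {T F e x} → x ∈ family T F e → F e ≡ true × IsEnd ends (vertex x) e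
  ∈-family⁻ {T} {F} {e} {x} x∈
    -- The equation in the last `with` argument refutes every case in which the conjunction is
    -- false.
    with F e | vertex x Fin.≟ proj₁ (ends e) | vertex x Fin.≟ proj₂ (ends e)
       | trans (sym (lookup∘tabulate (λ y → F e ∧ (does (vertex y Fin.≟ proj₁ (ends e))
                                                 ∨ does (vertex y Fin.≟ proj₂ (ends e)))) x))
               ([]=⇒lookup (p∩q⊆q T _ x∈))
  ... | true | yes eq | _      | _ = refl , inj₁ eq
  ... | true | no _   | yes eq | _ = refl , inj₂ eq

  part : (V → Bool) → Subset (∣S∣ G) → Subset (∣S∣ G)
  part W I = I ∩ tabulate (W ∘ vertex)

  α-part : ∀ W I v → α G (part W I) v ≡ α G I v unless not (W v)
  α-part W I v with W v in Wv
  ... | true  = cong ∣_∣ (tabulate-cong λ i → begin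
    lookup (part W I) (pair (deg G) v i)
      ≡⟨ lookup-zipWith _∧_ (pair (deg G) v i) I _ ⟩
    lookup I (pair (deg G) v i) ∧ lookup (tabulate (W ∘ vertex)) (pair (deg G) v i)
      ≡⟨ cong (lookup I (pair (deg G) v i) ∧_)
           (trans (lookup∘tabulate (W ∘ vertex) (pair (deg G) v i)) (trans (cong W (vertex-pair v i)) Wv)) ⟩
    lookup I (pair (deg G) v i) ∧ true
      ≡⟨ ∧-identityʳ _ ⟩
    lookup I (pair (deg G) v i) ∎)
    where open ≡-Reasoning
  ... | false = α-empty (part W I) v λ i pair∈ → contradiction
    (trans (sym ([]=⇒lookup (p∩q⊆q I _ pair∈)))
           (trans (lookup∘tabulate (W ∘ vertex) _) (trans (cong W (vertex-pair v i)) Wv))) λ ()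

  ∣X∣-split : ∀ W X → ∣ X ∣ ≡ weight ends (α G X) W + weight ends (α G X) (not ∘ W)
  ∣X∣-split W X = trans (∣X∣≡∑α X) (sum-unless-split W (α G X))

  -- Hall's inequality for `part W I`, with the number of elements of `I` outside `W` added to both
  -- sides. Elements at the same vertex lie in the same sets, so whole vertex blocks are the sets to
  -- test.
  HallCondition : (E → Bool) → Subset (∣S∣ G) → Set
  HallCondition F I = ∀ W → ∣ I ∣ ≤ cost ends F (α G I) W

  -- The elements of `I` at vertices of `W` are matched injectively to edges of `F` that touch `W`.
  transversal⇒hall : ∀ T F I → PartialTransversal (family T F) I → HallCondition F I
  transversal⇒hall T F I (f , f-inj , f∈) W = begin
    ∣ I ∣                                               ≡⟨ ∣X∣-split W I ⟩
    weight ends (α G I) W + weight ends (α G I) (not ∘ W)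
      ≡⟨ cong (λ s → weight ends (α G I) W + s) (sum-cong-≗ (α-part W I)) ⟨
    weight ends (α G I) W + sum (α G (part W I))        ≡⟨ cong (λ s → weight ends (α G I) W + s) (∣X∣≡∑α (part W I)) ⟨
    weight ends (α G I) W + ∣ part W I ∣                ≤⟨ ℕ.+-monoʳ-≤ (weight ends (α G I) W) part≤ ⟩
    weight ends (α G I) W + ∣ tabulate (λ e → F e ∧ touches ends W e) ∣
      ≡⟨ cong (λ s → weight ends (α G I) W + s) (∣tabulate∣ (λ e → F e ∧ touches ends W e)) ⟩
    cost ends F (α G I) W                               ∎
    where
    open ℕ.≤-Reasoning
    toI : ∃ (_∈ part W I) → ∃ (_∈ I)
    toI (x , x∈) = x , p∩q⊆p I _ x∈

    toI-injective : Injective _≡_ _≡_ toI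
    toI-injective {x , p} {y , q} eq with refl ← cong proj₁ eq = cong (x ,_) ([]=-irrelevant p q)

    f-covered : ∀ x → f (toI x) ∈ tabulate (λ e → F e ∧ touches ends W e)
    f-covered (x , x∈) with ∈-family⁻ {T} {F} (f∈ (toI (x , x∈)))
    ... | Fe , end = lookup⇒[]= _ _ (trans (lookup∘tabulate _ (f (toI (x , x∈)))) (cong₂ _∧_ Fe
      (touches-end ends W end (trans (sym (lookup∘tabulate (W ∘ vertex) x)) ([]=⇒lookup (p∩q⊆q I _ x∈))))))

    part≤ : ∣ part W I ∣ ≤ ∣ tabulate (λ e → F e ∧ touches ends W e) ∣
    part≤ = injection⇒∣p∣≤∣q∣ (part W I) _ (f ∘ toI) f-covered (toI-injective ∘ f-inj)

  -- An optimal labeling with |I| finite labels fills every capacity, so that the elements of I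
  -- at v can be matched with the edges labeled v.
  hall⇒transversal : ∀ T F I → I ⊆ T → HallCondition F I → PartialTransversal (family T F) I
  hall⇒transversal T F I I⊆T hall = f , f-injective , f∈
    where
    open MinMax (könig ends F (α G I))

    fibres-full : ∀ v → α G I v ≤ fibreSize G φ v
    fibres-full = sum-squeeze (proj₂ isLabeling) (begin
      sum (α G I)                                          ≡⟨ ∣X∣≡∑α I ⟨
      ∣ I ∣                                                ≤⟨ ℕ.≤-trans (hall W) tight ⟩
      Hei G φ                                              ≤⟨ Hei≤cost ends F φ (const false) (label-end ends φ isLabeling) supported ⟩
      sum (fibreSize G φ) + covered ends F (const false)
        ≡⟨ cong (λ s → sum (fibreSize G φ) + s) (sum-zero {f = λ e → ⟦ F e ∧ false ⟧} λ e → cong ⟦_⟧ (∧-zeroʳ (F e))) ⟩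
      sum (fibreSize G φ) + 0                              ≡⟨ ℕ.+-identityʳ _ ⟩
      sum (fibreSize G φ)                                  ∎)
      where open ℕ.≤-Reasoning

    slot≤ : ∀ v → count _inside? (slice (deg G) I v) ≤ fibreSize G φ v
    slot≤ v = ℕ.≤-trans (ℕ.≤-reflexive (sym (∣p∣≡count (slice (deg G) I v)))) (fibres-full v)

    fibre : ∀ v → _
    fibre v = nth (≡-dec Fin._≟_ (just v)) φ

    match : ∀ v i → lookup (slice (deg G) I v) i ≡ inside → E
    -- The place of `i` within the slice is reused as a place within the fibre of `v`, which is at
    -- least as large.
    match v i q = proj₁ (fibre v) (inject≤ (proj₁ (position _inside? (slice (deg G) I v)) i q) (slot≤ v))

    match-label : ∀ v i q → lookup φ (match v i q) ≡ just v
    match-label v i q = sym (proj₁ (proj₂ (fibre v)) _)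

    match-injective : ∀ v i q v′ i′ q′ → match v i q ≡ match v′ i′ q′ → pair (deg G) v i ≡ pair (deg G) v′ i′
    match-injective v i q v′ i′ q′ eq
      -- The label of the common edge determines the vertex, so only indices in one slice remain to
      -- be compared.
      with refl ← just-injective (trans (sym (match-label v i q)) (trans (cong (lookup φ) eq) (match-label v′ i′ q′))) =
      cong (pair (deg G) v) (proj₂ (position _inside? (slice (deg G) I v))
        (inject≤-injective _ _ _ _ (proj₂ (proj₂ (fibre v)) eq)))

    slot : ∀ {x} → x ∈ I → let v , i = unpair (deg G) x in lookup (slice (deg G) I v) i ≡ inside
    slot {x} x∈I = let v , i = unpair (deg G) x in
      trans (lookup-slice (deg G) I v i) (trans (cong (lookup I) (pair-unpair (deg G) x)) ([]=⇒lookup x∈I))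

    f : ∃ (_∈ I) → E
    f (x , x∈I) = let v , i = unpair (deg G) x in match v i (slot x∈I)

    f-injective : Injective _≡_ _≡_ f
    f-injective {x , p} {y , q} eq
      with refl ← trans (sym (pair-unpair (deg G) x)) (trans (match-injective _ _ _ _ _ _ eq) (pair-unpair (deg G) y)) =
      cong (x ,_) ([]=-irrelevant p q)

    f∈ : ∀ x → proj₁ x ∈ family T F (f x)
    f∈ (x , x∈I) = let label = match-label _ _ (slot x∈I) in
      ∈-family⁺ {F = F} (I⊆T x∈I) (supported _ _ label) (label-end ends φ isLabeling _ label)

  -- Since `ρ I` is the minimal cost and at most the size of `I`, equality with that size is exactly
  -- Hall's condition. A general `T` covers both the matroid and its deletions.
  transversal : ∀ T (isRank : IsRankFunction T (r G)) → Transversal (matroid T (r G) isRank)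
  transversal T isRank = ∣E∣ , family T every , (λ e → p∩q⊆p T _) , λ I I⊆T →
    mk⇔ {A = Independent (matroid T (r G) isRank) I}
    (λ (_ , ρ≡) → hall⇒transversal T every I I⊆T λ W →
      ℕ.≤-trans (ℕ.≤-reflexive (sym (ℤ.+-injective ρ≡))) (ρ≤cost I W))
    (λ pt → (λ {_} → I⊆T) , cong +_ (ℕ.≤-antisym (ρ≤∣X∣ I)
      (let W , tight = ρ-cover I in ℕ.≤-trans (transversal⇒hall T every I pt W) tight)))

  -- The dual of the deletion of a perfect set, presented by the edges with no end in that set

  module _ (X : Subset (∣S∣ G)) (perfect : Perfect G X) where

    T : Subset (∣S∣ G)
    T = ⊤ ─ X

    w : V → Bool
    w = lookup (proj₁ perfect)

    inner : E → Bool
    inner e = not (w (proj₁ (ends e))) ∧ not (w (proj₂ (ends e)))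

    -- The number of edges with an end outside `w`, which `ρ-T` identifies as the rank of the
    -- deletion.
    outer : ℕ
    outer = covered ends every (not ∘ w)

    α-T : ∀ v → α G T v ≡ deg G v unless w v
    α-T v with w v in wv
    ... | true  = α-empty T v λ i pair∈T → contradiction
      (subst (pair (deg G) v i ∈_) (p─q∩q≡⊥ ⊤ X)
        (x∈p∩q⁺ (pair∈T , Equivalence.from (proj₂ perfect v i) (lookup⇒[]= v _ wv)))) ∉⊥
    ... | false = α-full T v λ i → x∈p∧x∉q⇒x∈p─q ∈⊤ λ pair∈X → contradiction
      (trans (sym ([]=⇒lookup (Equivalence.to (proj₂ perfect v i) pair∈X))) wv) λ ()

    edgeTerm : (V → Bool) → E → ℕ
    edgeTerm W e = ⟦ not (W (proj₁ (ends e)) ∨ w (proj₁ (ends e))) ⟧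
                 + ⟦ not (W (proj₂ (ends e)) ∨ w (proj₂ (ends e))) ⟧ + ⟦ touches ends W e ⟧

    -- The vectors of `Y` and `T ─ Y` add up to the degree outside `w` and to zero on `w`. The joint
    -- weight is thus a degree sum outside both `W` and `w`, counted edge by edge.
    cost-T─Y : ∀ {Y} W → Y ⊆ T → cost ends every (α G (T ─ Y)) W + weight ends (α G Y) W ≡ sum (edgeTerm W)
    cost-T─Y {Y} W Y⊆T = begin
      weight ends (α G (T ─ Y)) W + covered ends every W + weight ends (α G Y) W
        ≡⟨ rearrange (weight ends (α G (T ─ Y)) W) _ _ ⟩
      weight ends (α G Y) W + weight ends (α G (T ─ Y)) W + covered ends every W
        ≡⟨ cong (λ s → s + covered ends every W) (sum-+ (λ v → α G Y v unless W v) _) ⟨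
      sum (λ v → α G Y v unless W v + α G (T ─ Y) v unless W v) + covered ends every W
        ≡⟨ cong (λ s → s + covered ends every W)
             (sum-cong-≗ λ v → pointwise (W v) (w v) (trans (α-─ T Y v Y⊆T) (α-T v))) ⟩
      weight ends (deg G) (λ v → W v ∨ w v) + covered ends every W
        ≡⟨ cong (λ s → s + covered ends every W) (weight-deg (λ v → W v ∨ w v)) ⟩
      sum (λ e → ⟦ not (W (proj₁ (ends e)) ∨ w (proj₁ (ends e))) ⟧ + ⟦ not (W (proj₂ (ends e)) ∨ w (proj₂ (ends e))) ⟧)
        + covered ends every W
        ≡⟨ sum-+ (λ e → ⟦ not (W (proj₁ (ends e)) ∨ w (proj₁ (ends e))) ⟧
                      + ⟦ not (W (proj₂ (ends e)) ∨ w (proj₂ (ends e))) ⟧) _ ⟨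
      sum (edgeTerm W) ∎
      where
      open ≡-Reasoning
      rearrange : ∀ a b c → a + b + c ≡ c + a + b
      rearrange = solve-∀

      pointwise : ∀ a b {x y z} → x + y ≡ z unless b → x unless a + y unless a ≡ z unless (a ∨ b)
      pointwise true  b eq = refl
      pointwise false b eq = eq

    outer+inner : ∀ W → sum (λ e → ⟦ touches ends (not ∘ w) e ⟧ + ⟦ inner e ∧ touches ends W e ⟧)
                      ≡ outer + covered ends inner W
    outer+inner W = sum-+ (λ e → ⟦ touches ends (not ∘ w) e ⟧) (λ e → ⟦ inner e ∧ touches ends W e ⟧)

    -- Take an optimal cover `W` of `T ─ Y`. Hall's condition for its complement bounds the weight
    -- of `Y` outside `W` by the inner edges touching that complement; the rest is a comparison at
    -- each edge.
    hall⇒outer≤ρ : ∀ Y → Y ⊆ T → HallCondition inner Y → outer ≤ ρ (T ─ Y)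
    hall⇒outer≤ρ Y Y⊆T hall = let W , tight = ρ-cover (T ─ Y) in
      ℕ.≤-trans (ℕ.+-cancelʳ-≤ (weight ends (α G Y) W) _ _ (begin
        outer + weight ends (α G Y) W                                ≤⟨ ℕ.+-monoʳ-≤ outer (weight≤ W) ⟩
        outer + covered ends inner (not ∘ W)                         ≡⟨ outer+inner (not ∘ W) ⟨
        sum (λ e → ⟦ touches ends (not ∘ w) e ⟧ + ⟦ inner e ∧ touches ends (not ∘ W) e ⟧)
          ≤⟨ sum-mono (λ e → bools (w (proj₁ (ends e))) (w (proj₂ (ends e))) (W (proj₁ (ends e))) (W (proj₂ (ends e)))) ⟩
        sum (edgeTerm W)                                             ≡⟨ cost-T─Y W Y⊆T ⟨
        cost ends every (α G (T ─ Y)) W + weight ends (α G Y) W      ∎)) tight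
      where
      open ℕ.≤-Reasoning
      weight≤ : ∀ W → weight ends (α G Y) W ≤ covered ends inner (not ∘ W)
      weight≤ W = ℕ.+-cancelʳ-≤ (weight ends (α G Y) (not ∘ W)) _ _ (begin
        weight ends (α G Y) W + weight ends (α G Y) (not ∘ W)  ≡⟨ ∣X∣-split W Y ⟨
        ∣ Y ∣                                                  ≤⟨ hall (not ∘ W) ⟩
        weight ends (α G Y) (not ∘ W) + covered ends inner (not ∘ W)
          ≡⟨ ℕ.+-comm (weight ends (α G Y) (not ∘ W)) _ ⟩
        covered ends inner (not ∘ W) + weight ends (α G Y) (not ∘ W) ∎)

      bools : ∀ u v a b → ⟦ not u ∨ not v ⟧ + ⟦ (not u ∧ not v) ∧ (not a ∨ not b) ⟧
                        ≤ ⟦ not (a ∨ u) ⟧ + ⟦ not (b ∨ v) ⟧ + ⟦ a ∨ b ⟧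
      bools = toWitness {a? = all-Bool? λ u → all-Bool? λ v → all-Bool? λ a → all-Bool? λ b → _ ℕ.≤? _} tt

    -- The cover by all vertices outside `w` has weight zero, as `T` has no elements on `w`. The
    -- lower bound is the preceding lemma for the empty `Y`.
    ρ-T : ρ T ≡ outer
    ρ-T = ℕ.≤-antisym
      (ℕ.≤-trans (ρ≤cost T (not ∘ w)) (ℕ.≤-reflexive (cong (λ s → s + outer)
        (sum-zero λ v → trans (cong (λ a → a unless not (w v)) (α-T v)) (vanish (w v) (deg G v))))))
      (subst (λ Z → outer ≤ ρ Z) (p─⊥≡p T)
        (hall⇒outer≤ρ ⊥ (⊆-min T) λ W → subst (λ c → c ≤ cost ends inner (α G ⊥) W) (sym (∣⊥∣≡0 (∣S∣ G))) z≤n))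
      where
      vanish : ∀ b x → (x unless b) unless not b ≡ 0
      vanish true  x = refl
      vanish false x = refl

    outer≤ρ⇒hall : ∀ Y → Y ⊆ T → outer ≤ ρ (T ─ Y) → HallCondition inner Y
    outer≤ρ⇒hall Y Y⊆T outer≤ W = begin
      ∣ Y ∣                                                  ≡⟨ ∣X∣-split W Y ⟩
      weight ends (α G Y) W + weight ends (α G Y) (not ∘ W)  ≤⟨ ℕ.+-monoʳ-≤ (weight ends (α G Y) W) weight≤ ⟩
      cost ends inner (α G Y) W                              ∎
      where
      open ℕ.≤-Reasoning
      -- The complement of `W` with the vertices of `w` also removed. This makes the edge comparison
      -- an equality, and the weight of `Y` does not suffer because `Y` has no elements on `w`.
      W′ : V → Bool
      W′ v = not (w v) ∧ not (W v)

      pointwise : ∀ a b {y d} → y ≤ d unless a → y unless not b ≤ y unless (not a ∧ not b)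
      -- At a vertex of `w` the bound is zero, which leaves only `zero` for `y`.
      pointwise true  b     {zero} y≤ = ℕ.≤-reflexive (zero-unless (not b))
      pointwise false b     y≤ = ℕ.≤-refl

      bools : ∀ u v a b →
        ⟦ not ((not u ∧ not a) ∨ u) ⟧ + ⟦ not ((not v ∧ not b) ∨ v) ⟧ + ⟦ (not u ∧ not a) ∨ (not v ∧ not b) ⟧
          ≡ ⟦ not u ∨ not v ⟧ + ⟦ (not u ∧ not v) ∧ (a ∨ b) ⟧
      bools = toWitness {a? = all-Bool? λ u → all-Bool? λ v → all-Bool? λ a → all-Bool? λ b → _ ℕ.≟ _} tt

      weight≤ : weight ends (α G Y) (not ∘ W) ≤ covered ends inner W
      weight≤ = ℕ.+-cancelˡ-≤ outer _ _ (begin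
        outer + weight ends (α G Y) (not ∘ W)
          ≤⟨ ℕ.+-mono-≤ (ℕ.≤-trans outer≤ (ρ≤cost (T ─ Y) W′))
               (sum-mono λ v → pointwise (w v) (W v) (ℕ.≤-trans (α-mono Y⊆T v) (ℕ.≤-reflexive (α-T v)))) ⟩
        cost ends every (α G (T ─ Y)) W′ + weight ends (α G Y) W′
          ≡⟨ cost-T─Y W′ Y⊆T ⟩
        sum (edgeTerm W′)
          ≡⟨ sum-cong-≗ (λ e → bools (w (proj₁ (ends e))) (w (proj₂ (ends e))) (W (proj₁ (ends e))) (W (proj₂ (ends e)))) ⟩
        sum (λ e → ⟦ touches ends (not ∘ w) e ⟧ + ⟦ inner e ∧ touches ends W e ⟧)
          ≡⟨ outer+inner W ⟩
        outer + covered ends inner W ∎)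

    -- By the formula for the dual rank, `Y` is independent in the dual exactly when removing it
    -- from `T` keeps the rank, that is, when `ρ (T ─ Y)` is still `outer`.
    transversal-dual : Transversal (dual (matroid ⊤ (r G) (isRankFunction ⊤) ∖ X))
    transversal-dual = ∣E∣ , family T inner , (λ e → p∩q⊆p T _) , λ Y Y⊆T →
      mk⇔ {A = Independent (dual (matroid ⊤ (r G) (isRankFunction ⊤) ∖ X)) Y}
      (λ (_ , r*≡) → hall⇒transversal T inner Y Y⊆T (outer≤ρ⇒hall Y Y⊆T
        (ℕ.≤-reflexive (trans (sym ρ-T) (sym (ℤ.+-injective (cancel (+ ∣ Y ∣) (+ ρ T) (+ ρ (T ─ Y)) r*≡)))))))
      (λ pt → (λ {_} → Y⊆T) , (begin
        + ∣ Y ∣ ℤ.- + ρ T ℤ.+ + ρ (T ─ Y)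
          ≡⟨ cong (λ c → + ∣ Y ∣ ℤ.- + ρ T ℤ.+ + c) (ℕ.≤-antisym (ρ-mono (p─q⊆p T Y))
               (subst (_≤ ρ (T ─ Y)) (sym ρ-T) (hall⇒outer≤ρ Y Y⊆T (transversal⇒hall T inner Y pt)))) ⟩
        + ∣ Y ∣ ℤ.- + ρ T ℤ.+ + ρ T
          ≡⟨ -+-cancel (+ ∣ Y ∣) (+ ρ T) ⟩
        + ∣ Y ∣ ∎))
      where
      open ≡-Reasoning
      -+-cancel : ∀ a b → a ℤ.- b ℤ.+ b ≡ a
      -+-cancel = ℤ-solve-∀

      isolate : ∀ a b c → c ≡ a ℤ.- b ℤ.+ c ℤ.- a ℤ.+ b
      isolate = ℤ-solve-∀

      cancel : ∀ a b c → a ℤ.- b ℤ.+ c ≡ a → c ≡ b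
      cancel a b c eq = begin
        c                             ≡⟨ isolate a b c ⟩
        a ℤ.- b ℤ.+ c ℤ.- a ℤ.+ b     ≡⟨ cong (λ d → d ℤ.- a ℤ.+ b) eq ⟩
        a ℤ.- a ℤ.+ b                 ≡⟨ cong (λ d → d ℤ.+ b) (ℤ.+-inverseʳ a) ⟩
        ℤ.0ℤ ℤ.+ b                    ≡⟨ ℤ.+-identityˡ b ⟩
        b                             ∎

theorem1p1 : (G : Graph) →
    Σ[ isRank ∈ IsRankFunction ⊤ (r G) ]
    let M = matroid ⊤ (r G) isRank in
    (IdenticallySelfDual M × Transversal M × Matroid.rank M (Matroid.ground M) ≡ + Graph.∣E∣ G)
    × (∀ X → Perfect G X → BiTransversal (M ∖ X))
theorem1p1 G =
  isRankFunction G ⊤ ,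
  (selfDual G , transversal G ⊤ (isRankFunction G ⊤) , cong +_ (ρ-⊤ G)) ,
  λ X perfect → transversal G (⊤ ─ X) (Matroid.isRankFunction (matroid ⊤ (r G) (isRankFunction G ⊤) ∖ X)) ,
                transversal-dual G X perfect
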